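{- Let $X$ be a bipartite distance-regular graph of diameter $d\geq 4$ on $n$ vertices. If a halved graph of $X$ is primitive, then $\mathrm{motion}(X)\geq (2d)^{ -2d-5}\,n$.
   Context: A distance-regular graph of diameter $d$ is a connected graph such that for vertices $v,w$ at distance $i$ the numbers of neighbours of $w$ at distance $i-1,i,i+1$ from $v$ are constants $c_i,a_i,b_i$. It is primitive if for every $1\le i\le d$ the distance-$i$ graph (same vertices, $u\sim v$ iff $\mathrm{dist}(u,v)=i$) is connected. For bipartite $X$, the halved graphs are the two connected components of the distance-2 graph of $X$ (one on each colour class); they are distance-regular. The motion of a graph is the minimum, over non-identity automorphisms, of the number of vertices not fixed. -}

module Defs where

open import Data.Bool using (Bool)
open import Data.Fin using (Fin; _≟_)
open import Data.Fin.Permutation using (Permutation′; _⟨$⟩ʳ_; _≈_; id)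
open import Data.Fin.Properties using (any?)
open import Data.Nat using (ℕ; zero; suc; _≤_; _<_; NonZero; z<s)
open import Data.Nat.Properties using (allUpTo?)
open import Data.Product using (Σ; ∃; ∃₂; _×_; _,_; proj₁; proj₂)
open import Data.Vec using (count; allFin)
open import Function using (_⇔_)
open import Level using (0ℓ)
open import Relation.Binary using (Rel; Symmetric; Decidable)
open import Relation.Binary.PropositionalEquality using (_≡_; _≢_; refl; sym)
open import Relation.Nullary using (¬_; ¬?; _×-dec_)
open import Relation.Unary using (Pred) renaming (Decidable to Decidable₁)

record Graph (V : Set) : Set₁ where
  infix 4 _∼_
  field
    _∼_      : Rel V 0ℓ
    ∼-sym    : Symmetric _∼_
    ∼-irrefl : ∀ {v} → ¬ (v ∼ v)

module _ {V : Set} (G : Graph V) where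
  open Graph G

  Walk : ℕ → Rel V 0ℓ
  Walk zero    u v = u ≡ v
  Walk (suc k) u v = ∃ λ w → u ∼ w × Walk k w v

  Dist : ℕ → Rel V 0ℓ
  Dist k u v = Walk k u v × (∀ {j} → j < k → ¬ Walk j u v)

  Connected : Set
  Connected = ∀ u v → ∃ λ k → Walk k u v

  HasDiameter : ℕ → Set
  HasDiameter d = (∀ u v → ∃ λ k → k ≤ d × Dist k u v) × (∃₂ λ u v → Dist d u v)

  walk-snoc : ∀ k {u v w} → Walk k u v → v ∼ w → Walk (suc k) u w
  walk-snoc zero    refl         e = _ , e , refl
  walk-snoc (suc k) (x , e′ , p) e = x , e′ , walk-snoc k p e

  walk-sym : ∀ k → Symmetric (Walk k)
  walk-sym zero    p           = sym p
  walk-sym (suc k) (_ , e , p) = walk-snoc k (walk-sym k p) (∼-sym e)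

  dist-sym : ∀ k → Symmetric (Dist k)
  dist-sym k (p , min) = walk-sym k p , λ {j} j<k q → min j<k (walk-sym j q)

  dist-irrefl : ∀ k .{{_ : NonZero k}} {v} → ¬ Dist k v v
  dist-irrefl (suc _) (_ , min) = min z<s refl

  distanceGraph : (i : ℕ) .{{_ : NonZero i}} → Graph V
  distanceGraph i = record
    { _∼_      = Dist i
    ; ∼-sym    = dist-sym i
    ; ∼-irrefl = dist-irrefl i
    }

  inducedSubgraph : (P : Pred V 0ℓ) → Graph (Σ V P)
  inducedSubgraph P = record
    { _∼_      = λ x y → proj₁ x ∼ proj₁ y
    ; ∼-sym    = ∼-sym
    ; ∼-irrefl = ∼-irrefl
    }

Primitive : {V : Set} → Graph V → Set
Primitive G = ∃ λ d → HasDiameter G d ×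
  (∀ i .{{_ : NonZero i}} → i ≤ d → Connected (distanceGraph G i))

record Bipartition {V : Set} (G : Graph V) : Set where
  open Graph G
  field
    colour : V → Bool
    proper : ∀ {u v} → u ∼ v → colour u ≢ colour v

-- For connected G the 2-colouring is unique up to swapping the colours, and
-- the two colour classes carry the two components of the distance-2 graph.
halvedGraph : {V : Set} (G : Graph V) (B : Bipartition G) (c : Bool) →
              Graph (Σ V λ v → Bipartition.colour B v ≡ c)
halvedGraph G B c = inducedSubgraph (distanceGraph G 2) (λ v → Bipartition.colour B v ≡ c)

record FiniteGraph (n : ℕ) : Set₁ where
  field
    graph : Graph (Fin n)
  open Graph graph public
  field
    _∼?_ : Decidable _∼_

#_ : ∀ {n} {P : Pred (Fin n) 0ℓ} → Decidable₁ P → ℕ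
# P? = count P? (allFin _)

module _ {n : ℕ} (G : FiniteGraph n) where
  open FiniteGraph G

  walk? : ∀ k → Decidable (Walk graph k)
  walk? zero    u v = u ≟ v
  walk? (suc k) u v = any? λ w → (u ∼? w) ×-dec walk? k w v

  dist? : ∀ k → Decidable (Dist graph k)
  dist? k u v = walk? k u v ×-dec allUpTo? (λ j → ¬? (walk? j u v)) k

  neighboursAtDistance : ℕ → (v w : Fin n) → ℕ
  neighboursAtDistance j v w = # λ z → (w ∼? z) ×-dec dist? j v z

  -- c₀ is left unconstrained, since no vertex is at distance -1.
  record IsDistanceRegular : Set where
    field
      connected : Connected graph
      c a b     : ℕ → ℕ
      c-count   : ∀ i {v w} → Dist graph (suc i) v w → neighboursAtDistance i v w ≡ c (suc i)
      a-count   : ∀ i {v w} → Dist graph i v w → neighboursAtDistance i v w ≡ a i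
      b-count   : ∀ i {v w} → Dist graph i v w → neighboursAtDistance (suc i) v w ≡ b i

  IsAutomorphism : Permutation′ n → Set
  IsAutomorphism σ = ∀ u v → (u ∼ v) ⇔ ((σ ⟨$⟩ʳ u) ∼ (σ ⟨$⟩ʳ v))

  -- No m satisfies this when the automorphism group is trivial, matching the
  -- convention that the minimum of the empty set is ∞.
  record IsMotion (m : ℕ) : Set where
    field
      attained : ∃ λ σ → IsAutomorphism σ × ¬ (σ ≈ id) × # (λ v → ¬? ((σ ⟨$⟩ʳ v) ≟ v)) ≡ m
      minimal  : ∀ σ → IsAutomorphism σ → ¬ (σ ≈ id) → m ≤ # (λ v → ¬? ((σ ⟨$⟩ʳ v) ≟ v))

{-# OPTIONS --safe #-}

-- Write k for the valency, K_i for the size of a sphere of radius i, and S for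
-- the support of a nontrivial automorphism σ. A point of S has at most c₂
-- fixed neighbours, because these are also adjacent to its image. Diameter at
-- least 4 gives 2c₂ ≤ k.
--
-- If 4c₂ ≤ k, let t be the first index with 2b_t < k. Counting edges between
-- consecutive spheres around x ∈ S shows that S contains at least a fraction
-- 2^-i of the sphere of radius i for i ≤ t, and every sphere has size at most
-- 2^d K_t. Hence n ≤ (d + 1) 4^d |S|.
--
-- If k < 4c₂, then K_{i+1} ≤ 4 K_i for i ≥ 1, so n ≤ (d + 1) 4^d k. Let D(u, v)
-- be the number of vertices whose distances to u and v differ. It depends only
-- on the distance of u and v, satisfies the triangle inequality, and
-- D(u, σu) ≤ |S|. At distance 2 it is at least k - c₂ ≥ k/2. If u and σu have
-- different colours then D(u, σu) = n. Otherwise primitivity of a halved graph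
-- joins two vertices at distance 2 by a walk whose steps all have the distance
-- of u and σu, and since D takes at most d + 1 values, k/2 ≤ (d + 1) |S|.
module Submission where

open import Defs
open import Axiom.UniquenessOfIdentityProofs using (module Decidable⇒UIP)
open import Data.Bool using (Bool; true; false; not; if_then_else_)
open import Data.Bool.Properties using (¬-not; not-¬; not-involutive; not-injective)
import Data.Bool.Properties as Bool
open import Data.Fin using (Fin; zero; suc; toℕ; fromℕ<)
open import Data.Fin.Permutation using (Permutation′; _⟨$⟩ʳ_; _⟨$⟩ˡ_; inverseˡ; inverseʳ)
open import Data.Fin.Properties using (pigeonhole; toℕ<n; any?; ¬∀⟶∃¬; fromℕ<-injective)
import Data.Fin.Properties as Fin
open import Data.Nat hiding (_/_)
open import Data.Nat.DivMod using (_/_; m*n/n≡m)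
open import Data.Nat.Properties hiding (≡-irrelevant)
open import Data.Nat.Solver using (module +-*-Solver)
open import Data.Product using (Σ; ∃; ∃₂; _×_; _,_; proj₁; proj₂)
open import Data.Sum using (_⊎_; inj₁; inj₂)
open import Data.Vec using (count; tabulate)
open import Function using (_∘_; Equivalence; id)
open import Level using (0ℓ)
open import Relation.Binary using (tri<; tri≈; tri>)
open import Relation.Binary.PropositionalEquality
open import Relation.Nullary using (¬_; ¬?; Dec; yes; no; does; contradiction; _×-dec_)
open import Relation.Nullary.Decidable using (dec-true; dec-false)
open import Relation.Unary using (Pred) renaming (Decidable to Decidable₁)
open import Algebra.Properties.Semiring.Sum +-*-semiring
open +-*-Solver using (solve; _:=_; _:+_; _:*_; _:^_; con)
open Decidable⇒UIP using (≡-irrelevant)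

*-reverse : ∀ x y z → x * (y * z) ≡ z * (y * x)
*-reverse = solve 3 (λ x y z → x :* (y :* z) := z :* (y :* x)) refl

double-+ : ∀ x y → x + y + (x + y) ≡ x + x + (y + y)
double-+ = solve 2 (λ x y → x :+ y :+ (x :+ y) := x :+ x :+ (y :+ y)) refl

-- Indicator functions and counting

⟦_⟧ : {P : Set} → Dec P → ℕ
⟦ p? ⟧ = if does p? then 1 else 0

module _ {P : Set} (p? : Dec P) where

  ⟦⟧-yes : P → ⟦ p? ⟧ ≡ 1
  ⟦⟧-yes p = cong (if_then 1 else 0) (dec-true p? p)

  ⟦⟧-no : ¬ P → ⟦ p? ⟧ ≡ 0
  ⟦⟧-no ¬p = cong (if_then 1 else 0) (dec-false p? ¬p)

  ⟦⟧-¬ : ⟦ p? ⟧ + ⟦ ¬? p? ⟧ ≡ 1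
  ⟦⟧-¬ with does p?
  ... | true  = refl
  ... | false = refl

  ⟦⟧-× : {Q : Set} (q? : Dec Q) → ⟦ p? ×-dec q? ⟧ ≡ ⟦ p? ⟧ * ⟦ q? ⟧
  ⟦⟧-× q? with does p?
  ... | true  = sym (*-identityˡ _)
  ... | false = refl

⟦⟧-mono : {P Q : Set} (p? : Dec P) (q? : Dec Q) → (P → Q) → ⟦ p? ⟧ ≤ ⟦ q? ⟧
⟦⟧-mono (yes p) q? f = ≤-reflexive (sym (⟦⟧-yes q? (f p)))
⟦⟧-mono (no _)  q? f = z≤n

⟦⟧-cong : {P Q : Set} (p? : Dec P) (q? : Dec Q) → (P → Q) → (Q → P) → ⟦ p? ⟧ ≡ ⟦ q? ⟧
⟦⟧-cong p? q? f g = ≤-antisym (⟦⟧-mono p? q? f) (⟦⟧-mono q? p? g)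

⟦⟧-∪ : {P Q R : Set} (p? : Dec P) (q? : Dec Q) (r? : Dec R) →
       (P → Q ⊎ R) → ⟦ p? ⟧ ≤ ⟦ q? ⟧ + ⟦ r? ⟧
⟦⟧-∪ (no _)  q? r? f = z≤n
⟦⟧-∪ (yes p) q? r? f with f p
... | inj₁ q = ≤-trans (≤-reflexive (sym (⟦⟧-yes q? q))) (m≤m+n _ _)
... | inj₂ r = ≤-trans (≤-reflexive (sym (⟦⟧-yes r? r))) (m≤n+m _ _)

⟦⟧-disjoint : {P Q : Set} (p? : Dec P) (q? : Dec Q) → (P → ¬ Q) → ⟦ p? ⟧ + ⟦ q? ⟧ ≤ 1
⟦⟧-disjoint (yes p) q?      disj = s≤s (≤-reflexive (⟦⟧-no q? (disj p)))
⟦⟧-disjoint (no _)  (yes _) disj = ≤-refl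
⟦⟧-disjoint (no _)  (no _)  disj = z≤n

⟦⟧-*-mono : {P : Set} (p? : Dec P) {x y : ℕ} → (P → x ≤ y) → ⟦ p? ⟧ * x ≤ ⟦ p? ⟧ * y
⟦⟧-*-mono (yes p) x≤y = *-monoʳ-≤ 1 (x≤y p)
⟦⟧-*-mono (no _)  x≤y = z≤n

⟦⟧-*-cong : {P : Set} (p? : Dec P) {x y : ℕ} → (P → x ≡ y) → ⟦ p? ⟧ * x ≡ ⟦ p? ⟧ * y
⟦⟧-*-cong (yes p) x≡y = cong (1 *_) (x≡y p)
⟦⟧-*-cong (no _)  x≡y = refl

∑-mono : ∀ {n} {f g : Fin n → ℕ} → (∀ i → f i ≤ g i) → sum f ≤ sum g
∑-mono {zero}  f≤g = z≤n
∑-mono {suc n} f≤g = +-mono-≤ (f≤g zero) (∑-mono (f≤g ∘ suc))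

∑-const : ∀ n x → ∑[ i < n ] x ≡ n * x
∑-const zero    x = refl
∑-const (suc n) x = cong (x +_) (∑-const n x)

∑≡0 : ∀ {n} {f : Fin n → ℕ} → (∀ i → f i ≡ 0) → sum f ≡ 0
∑≡0 {n} f≡0 = trans (sum-cong-≗ f≡0) (trans (∑-const n 0) (*-zeroʳ n))

term≤∑ : ∀ {n} (f : Fin n → ℕ) i → f i ≤ sum f
term≤∑ f zero    = m≤m+n _ _
term≤∑ f (suc i) = ≤-trans (term≤∑ (f ∘ suc) i) (m≤n+m _ _)

∑-⟦⟧>0 : ∀ {n} {P : Pred (Fin n) 0ℓ} (P? : Decidable₁ P) → 0 < sum (λ i → ⟦ P? i ⟧) → ∃ P
∑-⟦⟧>0 P? pos with any? P?
... | yes p = p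
... | no ¬p = contradiction (∑≡0 (λ i → ⟦⟧-no (P? i) (λ p → ¬p (i , p)))) (>⇒≢ pos)

count-tabulate : ∀ {n} {A : Set} {P : Pred A 0ℓ} (P? : Decidable₁ P) (f : Fin n → A) →
                 count P? (tabulate f) ≡ sum (λ i → ⟦ P? (f i) ⟧)
count-tabulate {zero}  P? f = refl
count-tabulate {suc n} P? f with does (P? (f zero))
... | true  = cong suc (count-tabulate P? (f ∘ suc))
... | false = count-tabulate P? (f ∘ suc)

#≡∑ : ∀ {n} {P : Pred (Fin n) 0ℓ} (P? : Decidable₁ P) → # P? ≡ sum (λ i → ⟦ P? i ⟧)
#≡∑ P? = count-tabulate P? id

-- Only the term with `h` equal to `x` survives. Applied with `x` a distance, this splits a function
-- of that distance into indicators of its values.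
∑-select : ∀ {N x} (F : ℕ → ℕ) → x < N → ∑[ h < N ] (⟦ x ≟ toℕ h ⟧ * F (toℕ h)) ≡ F x
∑-select {suc N} {zero}  F _ = begin
  1 * F 0 + ∑[ h < N ] (⟦ 0 ≟ suc (toℕ h) ⟧ * F (suc (toℕ h)))  ≡⟨ cong (1 * F 0 +_) (∑≡0 {N} λ _ → refl) ⟩
  1 * F 0 + 0                                                  ≡⟨ +-identityʳ _ ⟩
  1 * F 0                                                      ≡⟨ *-identityˡ _ ⟩
  F 0                                                          ∎
  where open ≡-Reasoning
∑-select {suc N} {suc x} F (s≤s x<N) = ∑-select (F ∘ suc) x<N

∑-point : ∀ {n} (f : Fin n → ℕ) u → ∑[ w < n ] (⟦ u Fin.≟ w ⟧ * f w) ≡ f u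
∑-point {suc n} f zero = begin
  1 * f zero + ∑[ w < n ] (⟦ zero Fin.≟ suc w ⟧ * f (suc w))  ≡⟨ cong (1 * f zero +_) (∑≡0 {n} λ _ → refl) ⟩
  1 * f zero + 0                                             ≡⟨ +-identityʳ _ ⟩
  1 * f zero                                                 ≡⟨ *-identityˡ _ ⟩
  f zero                                                     ∎
  where open ≡-Reasoning
∑-point {suc n} f (suc u) = ∑-point (f ∘ suc) u

-- Double counting: with `M` an adjacency matrix, the weighted edges between two sets are counted
-- from either side.
∑-swap : ∀ {m n} (M : Fin m → Fin n → ℕ) (f : Fin m → ℕ) (g : Fin n → ℕ) →
         ∑[ i < m ] (f i * ∑[ j < n ] (M i j * g j)) ≡ ∑[ j < n ] (g j * ∑[ i < m ] (M i j * f i))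
∑-swap {m} {n} M f g = begin
  ∑[ i < m ] (f i * ∑[ j < n ] (M i j * g j))  ≡⟨ sum-cong-≗ (λ i → *-distribˡ-sum (f i) (λ j → M i j * g j)) ⟩
  ∑[ i < m ] ∑[ j < n ] (f i * (M i j * g j))  ≡⟨ ∑-comm (λ i j → f i * (M i j * g j)) ⟩
  ∑[ j < n ] ∑[ i < m ] (f i * (M i j * g j))  ≡⟨ sum-cong-≗ (λ j → sum-cong-≗ (λ i → *-reverse (f i) (M i j) (g j))) ⟩
  ∑[ j < n ] ∑[ i < m ] (g j * (M i j * f i))  ≡⟨ sum-cong-≗ (λ j → *-distribˡ-sum (g j) (λ i → M i j * f i)) ⟨
  ∑[ j < n ] (g j * ∑[ i < m ] (M i j * f i))  ∎
  where open ≡-Reasoning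

-- Functions of bounded increment along a walk

module _ {V : Set} (G : Graph V) {N : ℕ} (class : V → Fin N) (g : V → ℕ) (m : ℕ)
         (g-class : ∀ u v → class u ≡ class v → g u ≡ g v)
         (g-step : ∀ {u v} → Graph._∼_ G u v → g v ≤ g u + m)
         where

  -- A discrete intermediate value argument: the first vertex whose value exceeds `s` follows one
  -- with value at most `s`, so it overshoots by at most `m`.
  crossing : ∀ l s {u v} → Walk G l u v → g u ≤ s → s < g v → ∃ λ w → s < g w × g w ≤ s + m
  crossing zero    s refl gu≤s s<gv = contradiction s<gv (≤⇒≯ gu≤s)
  crossing (suc l) s (w , u∼w , p) gu≤s s<gv with g w ≤? s
  ... | yes gw≤s = crossing l s p gw≤s s<gv
  ... | no  gw≰s = w , ≰⇒> gw≰s , ≤-trans (g-step u∼w) (+-monoˡ-≤ m gu≤s)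

  -- Otherwise each of the N + 1 intervals (s m, (s + 1) m] with s ≤ N contains
  -- a value of g, but g takes at most N values.
  bounded-on-walk : ∀ l {u v} → Walk G l u v → g u ≡ 0 → g v ≤ N * m
  bounded-on-walk l {u} {v} p gu≡0 with g v ≤? N * m
  ... | yes gv≤ = gv≤
  ... | no  gv≰ =
    let i , j , i<j , eq = pigeonhole (n<1+n N) (class ∘ point) in
    contradiction (g-class _ _ eq) (<⇒≢ (begin-strict
      g (point i)          ≤⟨ point-upper i ⟩
      toℕ i * m + m        ≡⟨ +-comm (toℕ i * m) m ⟩
      suc (toℕ i) * m      ≤⟨ *-monoˡ-≤ m i<j ⟩
      toℕ j * m            <⟨ point-lower j ⟩
      g (point j)          ∎))
    where
    open ≤-Reasoning
    hit : (s : Fin (suc N)) → ∃ λ w → toℕ s * m < g w × g w ≤ toℕ s * m + m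
    hit s = crossing l (toℕ s * m) p (subst (_≤ toℕ s * m) (sym gu≡0) z≤n)
              (≤-<-trans (*-monoˡ-≤ m (s≤s⁻¹ (toℕ<n s))) (≰⇒> gv≰))
    point : Fin (suc N) → V
    point = proj₁ ∘ hit
    point-lower : ∀ s → toℕ s * m < g (point s)
    point-lower = proj₁ ∘ proj₂ ∘ hit
    point-upper : ∀ s → g (point s) ≤ toℕ s * m + m
    point-upper = proj₂ ∘ proj₂ ∘ hit

-- The path metric

module Metric {V : Set} (G : Graph V) {d : ℕ}
              (bounded : ∀ u v → ∃ λ k → k ≤ d × Dist G k u v) where
  open Graph G

  δ : V → V → ℕ
  δ u v = proj₁ (bounded u v)

  δ≤d : ∀ u v → δ u v ≤ d
  δ≤d u v = proj₁ (proj₂ (bounded u v))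

  Dist-δ : ∀ u v → Dist G (δ u v) u v
  Dist-δ u v = proj₂ (proj₂ (bounded u v))

  walk-δ : ∀ u v → Walk G (δ u v) u v
  walk-δ u v = proj₁ (Dist-δ u v)

  Walk⇒δ≤ : ∀ k {u v} → Walk G k u v → δ u v ≤ k
  Walk⇒δ≤ k {u} {v} p = ≮⇒≥ λ k<δ → proj₂ (Dist-δ u v) k<δ p

  Dist⇒δ : ∀ {k u v} → Dist G k u v → δ u v ≡ k
  Dist⇒δ {k} {u} {v} (p , min) =
    ≤-antisym (Walk⇒δ≤ k p) (≮⇒≥ λ δ<k → min δ<k (walk-δ u v))

  δ⇒Dist : ∀ {k u v} → δ u v ≡ k → Dist G k u v
  δ⇒Dist {u = u} {v} refl = Dist-δ u v

  walk-++ : ∀ j k {u v w} → Walk G j u v → Walk G k v w → Walk G (j + k) u w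
  walk-++ zero    k refl        q = q
  walk-++ (suc j) k (x , e , p) q = x , e , walk-++ j k p q

  δ-refl : ∀ v → δ v v ≡ 0
  δ-refl v = n≤0⇒n≡0 (Walk⇒δ≤ 0 refl)

  δ≡0⇒≡ : ∀ {u v} → δ u v ≡ 0 → u ≡ v
  δ≡0⇒≡ {u} {v} eq = subst (λ k → Walk G k u v) eq (walk-δ u v)

  δ-sym : ∀ u v → δ u v ≡ δ v u
  δ-sym u v = Dist⇒δ (dist-sym G _ (Dist-δ v u))

  δ-triangle : ∀ u v w → δ u w ≤ δ u v + δ v w
  δ-triangle u v w = Walk⇒δ≤ _ (walk-++ (δ u v) (δ v w) (walk-δ u v) (walk-δ v w))

  ∼⇒δ≡1 : ∀ {u v} → u ∼ v → δ u v ≡ 1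
  ∼⇒δ≡1 {u} {v} e = ≤-antisym (Walk⇒δ≤ 1 (v , e , refl))
    (n≢0⇒n>0 λ δ≡0 → ∼-irrefl (subst (u ∼_) (sym (δ≡0⇒≡ δ≡0)) e))

  δ≡1⇒∼ : ∀ {u v} → δ u v ≡ 1 → u ∼ v
  δ≡1⇒∼ {u} {v} eq with subst (λ k → Walk G k u v) eq (walk-δ u v)
  ... | w , e , refl = e

  δ-stepʳ : ∀ u {v w} → v ∼ w → δ u w ≤ suc (δ u v)
  δ-stepʳ u {v} {w} e = ≤-trans (δ-triangle u v w)
    (≤-reflexive (trans (cong (δ u v +_) (∼⇒δ≡1 e)) (+-comm (δ u v) 1)))

  δ-stepˡ : ∀ {u v} w → u ∼ v → δ u w ≤ suc (δ v w)
  δ-stepˡ {u} {v} w e = subst₂ (λ x y → x ≤ suc y) (δ-sym w u) (δ-sym w v) (δ-stepʳ w (∼-sym e))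

  δ-pred : ∀ {h u v} → δ u v ≡ suc h → ∃ λ w → u ∼ w × δ w v ≡ h
  δ-pred {h} {u} {v} eq with subst (λ k → Walk G k u v) eq (walk-δ u v)
  ... | w , e , p = w , e , ≤-antisym (Walk⇒δ≤ h p)
                              (s≤s⁻¹ (subst (_≤ suc (δ w v)) eq (δ-stepˡ v e)))

  -- Follow a geodesic for `j` steps. The triangle inequality prevents the vertex reached from being
  -- closer to `u` than `j`.
  between : ∀ j {h u v} → δ u v ≡ j + h → ∃ λ w → δ u w ≡ j × δ w v ≡ h
  between zero    {h} {u} eq = u , δ-refl u , eq
  between (suc j) {h} {u} {v} eq with δ-pred eq
  ... | x , u∼x , δxv with between j δxv
  ...   | w , δxw , δwv = w , ≤-antisym upper lower , δwv
    where
    upper : δ u w ≤ suc j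
    upper = subst (λ k → δ u w ≤ suc k) δxw (δ-stepˡ w u∼x)
    lower : suc j ≤ δ u w
    lower = +-cancelʳ-≤ h (suc j) (δ u w)
      (subst₂ _≤_ eq (cong (δ u w +_) δwv) (δ-triangle u w v))

-- Parity of distances in a bipartite graph

alternate : ℕ → Bool → Bool
alternate zero    x = x
alternate (suc k) x = not (alternate k x)

alternate-not : ∀ k x → alternate k (not x) ≡ not (alternate k x)
alternate-not zero    x = refl
alternate-not (suc k) x = cong not (alternate-not k x)

alternate-injective : ∀ k {x y} → alternate k x ≡ alternate k y → x ≡ y
alternate-injective zero    eq = eq
alternate-injective (suc k) eq = alternate-injective k (not-injective eq)

alternate-double : ∀ k x → alternate (k + k) x ≡ x
alternate-double zero    x = refl
alternate-double (suc k) x = trans (cong (λ l → not (alternate l x)) (+-suc k k))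
  (trans (not-involutive _) (alternate-double k x))

alternate-even : ∀ k x → alternate k x ≡ x → ∃ λ j → k ≡ j + j
alternate-even zero          x eq = 0 , refl
alternate-even (suc zero)    x eq = contradiction (sym eq) (not-¬ refl)
alternate-even (suc (suc k)) x eq with alternate-even k x (trans (sym (not-involutive _)) eq)
... | j , refl = suc j , cong suc (sym (+-suc j j))

module Parity {V : Set} (G : Graph V) (B : Bipartition G) where
  open Graph G
  open Bipartition B

  colour-∼ : ∀ {u v} → u ∼ v → colour v ≡ not (colour u)
  colour-∼ e = ¬-not (proper (∼-sym e))

  colour-walk : ∀ k {u v} → Walk G k u v → colour v ≡ alternate k (colour u)
  colour-walk zero    refl            = refl
  colour-walk (suc k) {u} (w , e , p) = trans (colour-walk k p)
    (trans (cong (alternate k) (colour-∼ e)) (alternate-not k (colour u)))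

-- Intersection numbers of a distance-regular graph

module DistanceRegular {n d : ℕ} (X : FiniteGraph n) (regular : IsDistanceRegular X)
         (bounded : ∀ u v → ∃ λ k → k ≤ d × Dist (FiniteGraph.graph X) k u v) where
  open FiniteGraph X
  open IsDistanceRegular regular public
  open Metric graph bounded public

  -- `A` is the adjacency matrix and `E j` the distance-`j` matrix. The sums over a middle vertex
  -- below are products of such matrices.
  A : Fin n → Fin n → ℕ
  A u v = ⟦ u ∼? v ⟧

  E : ℕ → Fin n → Fin n → ℕ
  E j u v = ⟦ δ u v ≟ j ⟧

  A-sym : ∀ u v → A u v ≡ A v u
  A-sym u v = ⟦⟧-cong (u ∼? v) (v ∼? u) ∼-sym ∼-sym

  E-sym : ∀ j u v → E j u v ≡ E j v u
  E-sym j u v = cong (λ k → ⟦ k ≟ j ⟧) (δ-sym u v)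

  neighbours≡∑ : ∀ j v w → neighboursAtDistance X j v w ≡ ∑[ z < n ] (A w z * E j v z)
  neighbours≡∑ j v w = trans (#≡∑ (λ z → (w ∼? z) ×-dec dist? X j v z)) (sum-cong-≗ λ z →
    trans (⟦⟧-× (w ∼? z) (dist? X j v z))
          (cong (A w z *_) (⟦⟧-cong (dist? X j v z) (δ v z ≟ j) Dist⇒δ δ⇒Dist)))

  c-sum : ∀ i {v w} → δ v w ≡ suc i → ∑[ z < n ] (A w z * E i v z) ≡ c (suc i)
  c-sum i {v} {w} eq = trans (sym (neighbours≡∑ i v w)) (c-count i (δ⇒Dist eq))

  a-sum : ∀ i {v w} → δ v w ≡ i → ∑[ z < n ] (A w z * E i v z) ≡ a i
  a-sum i {v} {w} eq = trans (sym (neighbours≡∑ i v w)) (a-count i (δ⇒Dist eq))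

  b-sum : ∀ i {v w} → δ v w ≡ i → ∑[ z < n ] (A w z * E (suc i) v z) ≡ b i
  b-sum i {v} {w} eq = trans (sym (neighbours≡∑ (suc i) v w)) (b-count i (δ⇒Dist eq))

  c>0 : ∀ {i v w} → δ v w ≡ suc i → 0 < c (suc i)
  c>0 {i} {v} {w} eq with δ-pred (trans (δ-sym w v) eq)
  ... | z , w∼z , δzv = subst₂ _≤_ term (c-sum i eq) (term≤∑ (λ z → A w z * E i v z) z)
    where
    term : A w z * E i v z ≡ 1
    term = cong₂ _*_ (⟦⟧-yes (w ∼? z) w∼z) (⟦⟧-yes (δ v z ≟ i) (trans (δ-sym v z) δzv))

  -- `γ j` holds the coefficients in the three-term relation that writes `A` times `E j` through
  -- `E (j+1)`, `E j` and `E (j-1)`. The last summand is split off as `β`, since it is absent for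
  -- `j = 0`.
  β : ℕ → ℕ → ℕ
  β zero    h = 0
  β (suc j) h = ⟦ h ≟ j ⟧ * b j

  γ : ℕ → ℕ → ℕ
  γ j h = ⟦ h ≟ suc j ⟧ * c (suc j) + ⟦ h ≟ j ⟧ * a j + β j h

  β-no : ∀ j {h} → j ≢ suc h → β j h ≡ 0
  β-no zero        _  = refl
  β-no (suc j) {h} ne = cong (_* b j) (⟦⟧-no (h ≟ j) (λ eq → ne (cong suc (sym eq))))

  β-yes : ∀ h → β (suc h) h ≡ b h
  β-yes h = trans (cong (_* b h) (⟦⟧-yes (h ≟ h) refl)) (*-identityˡ (b h))

  γ-value : ∀ j h {x y z} → ⟦ h ≟ suc j ⟧ ≡ x → ⟦ h ≟ j ⟧ ≡ y → β j h ≡ z →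
            γ j h ≡ x * c (suc j) + y * a j + z
  γ-value j h refl refl refl = refl

  -- Adjacent vertices have distances to `v` that differ by at most one. So the sum is one of the
  -- constants `c`, `a`, `b` when `δ v w` is `j+1`, `j` or `j-1`, and is empty otherwise.
  γ-sum : ∀ j v w → ∑[ z < n ] (A w z * E j v z) ≡ γ j (δ v w)
  γ-sum j v w with δ v w in eq
  ... | h with h ≟ suc j | h ≟ j | j ≟ suc h
  ... | yes refl | _        | _        = trans (c-sum j eq) (sym (begin
          γ j h            ≡⟨ γ-value j h (⟦⟧-yes (h ≟ h) refl) (⟦⟧-no (h ≟ j) 1+n≢n) (β-no j (<⇒≢ (m<n+m j z<s))) ⟩
          1 * c h + 0 + 0  ≡⟨ trans (+-identityʳ _) (+-identityʳ _) ⟩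
          1 * c h          ≡⟨ *-identityˡ _ ⟩
          c h              ∎))
    where open ≡-Reasoning
  ... | no h≢1+j | yes refl | _        = trans (a-sum j eq) (sym (begin
          γ j h            ≡⟨ γ-value j h (⟦⟧-no (h ≟ suc j) h≢1+j) (⟦⟧-yes (h ≟ h) refl) (β-no h (<⇒≢ (n<1+n h))) ⟩
          1 * a h + 0      ≡⟨ +-identityʳ _ ⟩
          1 * a h          ≡⟨ *-identityˡ _ ⟩
          a h              ∎))
    where open ≡-Reasoning
  ... | no h≢1+j | no h≢j   | yes refl = trans (b-sum h eq) (sym
          (γ-value j h (⟦⟧-no (h ≟ suc j) h≢1+j) (⟦⟧-no (h ≟ j) h≢j) (β-yes h)))
  ... | no h≢1+j | no h≢j   | no j≢1+h = trans (∑≡0 far) (sym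
          (γ-value j h (⟦⟧-no (h ≟ suc j) h≢1+j) (⟦⟧-no (h ≟ j) h≢j) (β-no j j≢1+h)))
    where
    far : ∀ z → A w z * E j v z ≡ 0
    far z with w ∼? z
    ... | no  _   = refl
    -- Here `h` and `j` differ by at most one; excluding `h = j+1`, `j = h+1` and `h = j` leaves
    -- both `h ≤ j` and `j < h`.
    ... | yes w∼z = cong (1 *_) (⟦⟧-no (δ v z ≟ j) λ δvz → contradiction
      (≤∧≢⇒< (subst₂ (λ x y → x ≤ suc y) eq δvz (δ-stepʳ v (∼-sym w∼z))) h≢1+j)
      (<⇒≱ (s≤s (≤∧≢⇒< (s≤s⁻¹ (≤∧≢⇒< (subst₂ (λ x y → x ≤ suc y) δvz eq (δ-stepʳ v w∼z)) j≢1+h)) (≢-sym h≢j)))))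

  γ-sum′ : ∀ j u v → ∑[ x < n ] (E j x v * A u x) ≡ γ j (δ u v)
  γ-sum′ j u v = begin
    ∑[ x < n ] (E j x v * A u x)  ≡⟨ sum-cong-≗ (λ x → trans (*-comm (E j x v) (A u x)) (cong (A u x *_) (E-sym j x v))) ⟩
    ∑[ x < n ] (A u x * E j v x)  ≡⟨ γ-sum j v u ⟩
    γ j (δ v u)                   ≡⟨ cong (γ j) (δ-sym v u) ⟩
    γ j (δ u v)                   ∎
    where open ≡-Reasoning

  -- Products of distance matrices

  p : ℕ → ℕ → Fin n → Fin n → ℕ
  p i j u v = ∑[ w < n ] (E i u w * E j v w)

  -- Such functions are combinations of the distance matrices, that is, elements of the Bose-Mesner
  -- algebra, with the coefficient function carried as data.
  ClassFunction : (Fin n → Fin n → ℕ) → Set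
  ClassFunction f = Σ (ℕ → ℕ) λ F → ∀ u v → f u v ≡ F (δ u v)

  -- The product of the adjacency matrix with `f`: a sum over neighbours, without division by the
  -- valency.
  average : (Fin n → Fin n → ℕ) → Fin n → Fin n → ℕ
  average f u v = ∑[ x < n ] (A u x * f x v)

  -- Expand `f` in the distance matrices and apply the three-term relation to each of them.
  average-class : ∀ {f} → ClassFunction f → ClassFunction (average f)
  average-class {f} (F , f≡F) = (λ h → ∑[ j < suc d ] (F (toℕ j) * γ (toℕ j) h)) , λ u v → begin
    ∑[ x < n ] (A u x * f x v)
      ≡⟨ sum-cong-≗ (λ x → cong (A u x *_) (trans (f≡F x v) (sym (∑-select F (s≤s (δ≤d x v)))))) ⟩
    ∑[ x < n ] (A u x * ∑[ j < suc d ] (E (toℕ j) x v * F (toℕ j)))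
      ≡⟨ ∑-swap (λ x (j : Fin (suc d)) → E (toℕ j) x v) (A u) (F ∘ toℕ) ⟩
    ∑[ j < suc d ] (F (toℕ j) * ∑[ x < n ] (E (toℕ j) x v * A u x))
      ≡⟨ sum-cong-≗ (λ (j : Fin (suc d)) → cong (F (toℕ j) *_) (γ-sum′ (toℕ j) u v)) ⟩
    ∑[ j < suc d ] (F (toℕ j) * γ (toℕ j) (δ u v))
      ∎
    where open ≡-Reasoning

  b-term : ℕ → ℕ → Fin n → Fin n → ℕ
  b-term zero    j u v = 0
  b-term (suc i) j u v = b i * p i j u v

  β-term : ∀ i j u v → ∑[ w < n ] (E j v w * β i (δ u w)) ≡ b-term i j u v
  β-term zero    j u v = ∑≡0 (λ w → *-zeroʳ (E j v w))
  β-term (suc i) j u v = begin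
    ∑[ w < n ] (E j v w * (E i u w * b i))  ≡⟨ sum-cong-≗ (λ w → *-reverse (E j v w) (E i u w) (b i)) ⟩
    ∑[ w < n ] (b i * (E i u w * E j v w))  ≡⟨ *-distribˡ-sum (b i) (λ w → E i u w * E j v w) ⟨
    b i * p i j u v                         ∎
    where open ≡-Reasoning

  -- The three-term relation for `A` times `E i`, multiplied on the right by `E j`; `b-term`
  -- supplies the zero that takes the place of index -1.
  p-recurrence : ∀ i j u v →
    average (p i j) u v ≡ c (suc i) * p (suc i) j u v + (a i * p i j u v + b-term i j u v)
  p-recurrence i j u v = begin
    ∑[ x < n ] (A u x * p i j x v)
      ≡⟨ ∑-swap (E i) (A u) (E j v) ⟩
    ∑[ w < n ] (E j v w * ∑[ x < n ] (E i x w * A u x))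
      ≡⟨ sum-cong-≗ (λ w → cong (E j v w *_) (γ-sum′ i u w)) ⟩
    ∑[ w < n ] (E j v w * γ i (δ u w))
      ≡⟨ sum-cong-≗ (λ w → rearrange (E j v w) (E (suc i) u w) (c (suc i)) (E i u w) (a i) (β i (δ u w))) ⟩
    ∑[ w < n ] (c (suc i) * (E (suc i) u w * E j v w) + (a i * (E i u w * E j v w) + E j v w * β i (δ u w)))
      ≡⟨ ∑-distrib-+ (λ w → c (suc i) * (E (suc i) u w * E j v w)) (λ w → a i * (E i u w * E j v w) + E j v w * β i (δ u w)) ⟩
    ∑[ w < n ] (c (suc i) * (E (suc i) u w * E j v w)) + ∑[ w < n ] (a i * (E i u w * E j v w) + E j v w * β i (δ u w))
      ≡⟨ cong₂ _+_ (sym (*-distribˡ-sum (c (suc i)) (λ w → E (suc i) u w * E j v w)))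
           (trans (∑-distrib-+ (λ w → a i * (E i u w * E j v w)) (λ w → E j v w * β i (δ u w)))
             (cong₂ _+_ (sym (*-distribˡ-sum (a i) (λ w → E i u w * E j v w))) (β-term i j u v))) ⟩
    c (suc i) * p (suc i) j u v + (a i * p i j u v + b-term i j u v)
      ∎
    where
    open ≡-Reasoning
    rearrange : ∀ e x k y l z → e * (x * k + y * l + z) ≡ k * (x * e) + (l * (y * e) + e * z)
    rearrange = solve 6 (λ e x k y l z → e :* (x :* k :+ y :* l :+ z) := k :* (x :* e) :+ (l :* (y :* e) :+ e :* z)) refl

  -- Solves the equation for `f`. Both the truncated subtraction and the division are exact on the
  -- values that occur, and a vanishing coefficient `k` requires `f` to be known to vanish.
  solve-class : ∀ {f g r} k → ClassFunction g → ClassFunction r →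
                (∀ u v → g u v ≡ k * f u v + r u v) → (k ≡ 0 → ∀ u v → f u v ≡ 0) → ClassFunction f
  solve-class zero    _         _         _  f≡0 = (λ _ → 0) , f≡0 refl
  solve-class {f} {g} {r} (suc k) (G , g≡G) (R , r≡R) eq _ = (λ h → (G h ∸ R h) / suc k) , λ u v → sym (begin
    (G (δ u v) ∸ R (δ u v)) / suc k                ≡⟨ cong₂ (λ x y → (x ∸ y) / suc k) (g≡G u v) (r≡R u v) ⟨
    (g u v ∸ r u v) / suc k                        ≡⟨ cong (λ x → (x ∸ r u v) / suc k) (eq u v) ⟩
    (suc k * f u v + r u v ∸ r u v) / suc k        ≡⟨ cong (_/ suc k) (m+n∸n≡m (suc k * f u v) (r u v)) ⟩
    (suc k * f u v) / suc k                        ≡⟨ cong (_/ suc k) (*-comm (suc k) (f u v)) ⟩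
    (f u v * suc k) / suc k                        ≡⟨ m*n/n≡m (f u v) (suc k) ⟩
    f u v                                          ∎)
    where open ≡-Reasoning

  p-vanishes : ∀ i j → c (suc i) ≡ 0 → ∀ u v → p (suc i) j u v ≡ 0
  p-vanishes i j c≡0 u v = ∑≡0 λ w → cong (_* E j v w)
    (⟦⟧-no (δ u w ≟ suc i) λ eq → contradiction c≡0 (>⇒≢ (c>0 eq)))

  -- Existence of the intersection numbers, by induction on `i`: the recurrence is solved for
  -- `p (suc i) j`. If `c (suc i)` is zero, no two vertices have distance `suc i`.
  p-class : ∀ i j → ClassFunction (p i j)
  b-term-class : ∀ i j → ClassFunction (b-term i j)

  p-class zero j = (λ h → ⟦ h ≟ j ⟧) , λ u v → begin
    ∑[ w < n ] (E 0 u w * E j v w)            ≡⟨ sum-cong-≗ (λ w → cong (_* E j v w) (⟦⟧-cong (δ u w ≟ 0) (u Fin.≟ w) δ≡0⇒≡ (λ { refl → δ-refl u }))) ⟩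
    ∑[ w < n ] (⟦ u Fin.≟ w ⟧ * E j v w)      ≡⟨ ∑-point (E j v) u ⟩
    E j v u                                   ≡⟨ E-sym j v u ⟩
    E j u v                                   ∎
    where open ≡-Reasoning
  p-class (suc i) j with p-class i j | b-term-class i j
  ... | F , p≡F | H , b≡H = solve-class (c (suc i)) (average-class (F , p≡F))
    ((λ h → a i * F h + H h) , λ u v → cong₂ (λ x y → a i * x + y) (p≡F u v) (b≡H u v))
    (p-recurrence i j) (p-vanishes i j)

  b-term-class zero    j = (λ _ → 0) , λ _ _ → refl
  b-term-class (suc i) j with p-class i j
  ... | F , p≡F = (λ h → b i * F h) , λ u v → cong (b i *_) (p≡F u v)

  -- Sphere sizes

  K : ℕ → Fin n → ℕ
  K i x = ∑[ y < n ] E i x y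

  K≡p : ∀ i x → K i x ≡ p i i x x
  K≡p i x = sum-cong-≗ λ y → square (δ x y ≟ i)
    where
    square : {P : Set} (p? : Dec P) → ⟦ p? ⟧ ≡ ⟦ p? ⟧ * ⟦ p? ⟧
    square (yes _) = refl
    square (no _)  = refl

  -- The size of a sphere is a diagonal value of `p i i`, which depends only on the distance of the
  -- centre to itself.
  K-constant : ∀ i x y → K i x ≡ K i y
  K-constant i x y with p-class i i
  ... | F , p≡F = begin
    K i x      ≡⟨ K≡p i x ⟩
    p i i x x  ≡⟨ p≡F x x ⟩
    F (δ x x)  ≡⟨ cong F (trans (δ-refl x) (sym (δ-refl y))) ⟩
    F (δ y y)  ≡⟨ p≡F y y ⟨
    p i i y y  ≡⟨ K≡p i y ⟨
    K i y      ∎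
    where open ≡-Reasoning

  sphere-nonempty : ∀ {i u v} → δ u v ≡ i → ∀ x → ∃ λ y → δ x y ≡ i
  sphere-nonempty {i} {u} {v} eq x = ∑-⟦⟧>0 (λ y → δ x y ≟ i) (begin
    1      ≡⟨ ⟦⟧-yes (δ u v ≟ i) eq ⟨
    E i u v ≤⟨ term≤∑ (E i u) v ⟩
    K i u  ≡⟨ K-constant i u x ⟩
    K i x  ∎)
    where open ≤-Reasoning

  ∑K≡n : ∀ x → ∑[ i < suc d ] K (toℕ i) x ≡ n
  ∑K≡n x = begin
    ∑[ i < suc d ] ∑[ y < n ] E (toℕ i) x y        ≡⟨ ∑-comm (λ (i : Fin (suc d)) → E (toℕ i) x) ⟩
    ∑[ y < n ] ∑[ i < suc d ] E (toℕ i) x y        ≡⟨ sum-cong-≗ (λ y → sum-cong-≗ (λ (i : Fin (suc d)) → *-identityʳ (E (toℕ i) x y))) ⟨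
    ∑[ y < n ] ∑[ i < suc d ] (E (toℕ i) x y * 1)  ≡⟨ sum-cong-≗ (λ y → ∑-select (λ _ → 1) (s≤s (δ≤d x y))) ⟩
    ∑[ y < n ] 1                                   ≡⟨ ∑-const n 1 ⟩
    n * 1                                          ≡⟨ *-identityʳ n ⟩
    n                                              ∎
    where open ≡-Reasoning

  onSphere : ∀ i x (f : Fin n → ℕ) k → (∀ {y} → δ x y ≡ i → f y ≡ k) → ∑[ y < n ] (E i x y * f y) ≡ K i x * k
  onSphere i x f k f≡k = begin
    ∑[ y < n ] (E i x y * f y)  ≡⟨ sum-cong-≗ (λ y → ⟦⟧-*-cong (δ x y ≟ i) f≡k) ⟩
    ∑[ y < n ] (E i x y * k)    ≡⟨ *-distribʳ-sum k (E i x) ⟨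
    K i x * k                   ∎
    where open ≡-Reasoning

  -- Both sides count the edges between two consecutive spheres around `x`.
  K-step : ∀ i x → K i x * b i ≡ K (suc i) x * c (suc i)
  K-step i x = begin
    K i x * b i                                              ≡⟨ onSphere i x (λ y → ∑[ z < n ] (A y z * E (suc i) x z)) (b i) (b-sum i) ⟨
    ∑[ y < n ] (E i x y * ∑[ z < n ] (A y z * E (suc i) x z))  ≡⟨ ∑-swap A (E i x) (E (suc i) x) ⟩
    ∑[ z < n ] (E (suc i) x z * ∑[ y < n ] (A y z * E i x y))  ≡⟨ onSphere (suc i) x (λ z → ∑[ y < n ] (A y z * E i x y)) (c (suc i))
                                                                   (λ {z} eq → trans (sum-cong-≗ (λ y → cong (_* E i x y) (A-sym y z))) (c-sum i eq)) ⟩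
    K (suc i) x * c (suc i)                                  ∎
    where open ≡-Reasoning

  -- Vertices distinguishing a pair

  D : Fin n → Fin n → ℕ
  D u v = ∑[ w < n ] ⟦ ¬? (δ u w ≟ δ v w) ⟧

  -- The vertices that do not distinguish `u` and `v` are counted by the sum of `p i i u v` over all
  -- radii `i`, and each summand depends only on the distance of `u` and `v`.
  D-class : ∀ {u v u′ v′} → δ u v ≡ δ u′ v′ → D u v ≡ D u′ v′
  D-class {u} {v} {u′} {v′} eq = +-cancelˡ-≡ (S u v) _ _ (begin
    S u v + D u v      ≡⟨ total u v ⟩
    n                  ≡⟨ total u′ v′ ⟨
    S u′ v′ + D u′ v′  ≡⟨ cong (_+ D u′ v′) S-const ⟨
    S u v + D u′ v′    ∎)
    where
    open ≡-Reasoning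
    S : Fin n → Fin n → ℕ
    S u v = ∑[ i < suc d ] p (toℕ i) (toℕ i) u v

    S≡ : ∀ u v → S u v ≡ ∑[ w < n ] ⟦ δ u w ≟ δ v w ⟧
    S≡ u v = begin
      ∑[ i < suc d ] ∑[ w < n ] (E (toℕ i) u w * E (toℕ i) v w)
        ≡⟨ ∑-comm (λ (i : Fin (suc d)) w → E (toℕ i) u w * E (toℕ i) v w) ⟩
      ∑[ w < n ] ∑[ i < suc d ] (E (toℕ i) u w * E (toℕ i) v w)
        ≡⟨ sum-cong-≗ (λ w → ∑-select (λ i → ⟦ δ v w ≟ i ⟧) (s≤s (δ≤d u w))) ⟩
      ∑[ w < n ] ⟦ δ v w ≟ δ u w ⟧
        ≡⟨ sum-cong-≗ (λ w → ⟦⟧-cong (δ v w ≟ δ u w) (δ u w ≟ δ v w) sym sym) ⟩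
      ∑[ w < n ] ⟦ δ u w ≟ δ v w ⟧
        ∎

    total : ∀ u v → S u v + D u v ≡ n
    total u v = begin
      S u v + D u v                                            ≡⟨ cong (_+ D u v) (S≡ u v) ⟩
      ∑[ w < n ] ⟦ δ u w ≟ δ v w ⟧ + D u v                     ≡⟨ ∑-distrib-+ (λ w → ⟦ δ u w ≟ δ v w ⟧) (λ w → ⟦ ¬? (δ u w ≟ δ v w) ⟧) ⟨
      ∑[ w < n ] (⟦ δ u w ≟ δ v w ⟧ + ⟦ ¬? (δ u w ≟ δ v w) ⟧)  ≡⟨ sum-cong-≗ (λ w → ⟦⟧-¬ (δ u w ≟ δ v w)) ⟩
      ∑[ w < n ] 1                                             ≡⟨ ∑-const n 1 ⟩
      n * 1                                                    ≡⟨ *-identityʳ n ⟩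
      n                                                        ∎

    S-const : S u v ≡ S u′ v′
    S-const = sum-cong-≗ λ (i : Fin (suc d)) → let F , p≡F = p-class (toℕ i) (toℕ i) in
      trans (p≡F u v) (trans (cong F eq) (sym (p≡F u′ v′)))

  D-refl : ∀ u → D u u ≡ 0
  D-refl u = ∑≡0 λ w → ⟦⟧-no (¬? (δ u w ≟ δ u w)) λ ne → ne refl

  D-triangle : ∀ u v w → D u w ≤ D u v + D v w
  D-triangle u v w = ≤-trans (∑-mono pointwise)
    (≤-reflexive (∑-distrib-+ (λ x → ⟦ ¬? (δ u x ≟ δ v x) ⟧) (λ x → ⟦ ¬? (δ v x ≟ δ w x) ⟧)))
    where
    pointwise : ∀ x → ⟦ ¬? (δ u x ≟ δ w x) ⟧ ≤ ⟦ ¬? (δ u x ≟ δ v x) ⟧ + ⟦ ¬? (δ v x ≟ δ w x) ⟧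
    pointwise x = ⟦⟧-∪ (¬? (δ u x ≟ δ w x)) (¬? (δ u x ≟ δ v x)) (¬? (δ v x ≟ δ w x)) split
      where
      split : δ u x ≢ δ w x → δ u x ≢ δ v x ⊎ δ v x ≢ δ w x
      split ne with δ u x ≟ δ v x
      ... | no ne′ = inj₁ ne′
      ... | yes eq = inj₂ λ eq′ → ne (trans eq eq′)

-- Least element of a decidable set of numbers

first : ∀ {P : Pred ℕ 0ℓ} → Decidable₁ P → ∀ N → P N → ∃ λ t → t ≤ N × P t × (∀ {j} → j < t → ¬ P j)
first P? zero    pN = 0 , z≤n , pN , λ ()
first P? (suc N) pN with P? 0
... | yes p0 = 0 , z≤n , p0 , λ ()
... | no ¬p0 with first (P? ∘ suc) N pN
...   | t , t≤N , pt , min = suc t , s≤s t≤N , pt , λ { {zero} _ → ¬p0 ; {suc j} (s≤s j<t) → min j<t }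

-- Distances in the halved graphs

module Halved {V : Set} (G : Graph V) {d : ℕ} (bounded : ∀ u v → ∃ λ k → k ≤ d × Dist G k u v)
              (B : Bipartition G) (κ : Bool) where
  open Graph G
  open Bipartition B
  open Metric G bounded
  open Parity G B

  H : Graph (Σ V λ v → colour v ≡ κ)
  H = halvedGraph G B κ

  halved-walk⇒walk : ∀ k {x y} → Walk H k x y → Walk G (k + k) (proj₁ x) (proj₁ y)
  halved-walk⇒walk zero    refl                = refl
  halved-walk⇒walk (suc k) {x} {y} (w , (q , _) , r) =
    subst (λ l → Walk G l (proj₁ x) (proj₁ y)) (cong suc (sym (+-suc k k))) (walk-++ 2 (k + k) q (halved-walk⇒walk k r))

  -- Every second vertex of a geodesic of even length has the colour of its start, so the geodesic
  -- can be cut into steps of length 2 inside the colour class.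
  geodesic⇒halved-walk : ∀ j x y → δ (proj₁ x) (proj₁ y) ≡ j + j → Walk H j x y
  geodesic⇒halved-walk zero (x , x∈) (y , y∈) eq with δ≡0⇒≡ eq
  -- Vertices of the halved graph carry a proof of their colour, so equality of the endpoints also
  -- needs uniqueness of these proofs.
  ... | refl = cong (x ,_) (≡-irrelevant Bool._≟_ x∈ y∈)
  geodesic⇒halved-walk (suc j) (x , x∈) (y , y∈) eq =
    (w , w∈) , δ⇒Dist δxw , geodesic⇒halved-walk j (w , w∈) (y , y∈) (proj₂ (proj₂ middle))
    where
    middle : ∃ λ w → δ x w ≡ 2 × δ w y ≡ j + j
    middle = between 2 (trans eq (cong suc (+-suc j j)))
    w : V
    w = proj₁ middle
    δxw : δ x w ≡ 2
    δxw = proj₁ (proj₂ middle)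
    w∈ : colour w ≡ κ
    w∈ = trans (colour-walk 2 (proj₁ (δ⇒Dist δxw))) (trans (not-involutive (colour x)) x∈)

  -- Distances within a colour class are even. Doubling a halved walk bounds the distance above;
  -- halving a geodesic bounds it below.
  halved-dist⇒δ : ∀ {j x y} → Dist H j x y → δ (proj₁ x) (proj₁ y) ≡ j + j
  halved-dist⇒δ {j} {x , x∈} {y , y∈} (q , min)
    with alternate-even (δ x y) (colour x) (trans (sym (colour-walk (δ x y) (walk-δ x y))) (trans y∈ (sym x∈)))
  ... | i , eq = ≤-antisym (Walk⇒δ≤ (j + j) (halved-walk⇒walk j q)) (subst (j + j ≤_) (sym eq) (+-mono-≤ j≤i j≤i))
    where
    j≤i : j ≤ i
    j≤i = ≮⇒≥ λ i<j → min i<j (geodesic⇒halved-walk i (x , x∈) (y , y∈) eq)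

-- Bipartite distance-regular graphs of diameter at least 4

module BipartiteDistanceRegular {n d : ℕ} (X : FiniteGraph n) (regular : IsDistanceRegular X)
         (diameter : HasDiameter (FiniteGraph.graph X) d) (4≤d : 4 ≤ d)
         (B : Bipartition (FiniteGraph.graph X)) where
  open FiniteGraph X
  open Bipartition B
  open Parity graph B
  open DistanceRegular X regular (proj₁ diameter)

  colour-δ : ∀ u v → colour v ≡ alternate (δ u v) (colour u)
  colour-δ u v = colour-walk (δ u v) (walk-δ u v)

  -- The final segments of a geodesic of length `d` have every length up to `d`.
  attained : ∀ {h} → h ≤ d → ∃₂ λ u v → δ u v ≡ h
  attained {h} h≤d with proj₂ diameter
  ... | u , v , dist with between (d ∸ h) (trans (Dist⇒δ dist) (sym (m∸n+n≡m h≤d)))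
  ...   | w , _ , δwv = w , v , δwv

  k : ℕ
  k = b 0

  degree : ∀ w → ∑[ z < n ] A w z ≡ k
  degree w = trans (sum-cong-≗ λ z → trans (sym (*-identityʳ (A w z)))
    (⟦⟧-*-cong (w ∼? z) λ w∼z → sym (⟦⟧-yes (δ w z ≟ 1) (∼⇒δ≡1 w∼z)))) (b-sum 0 (δ-refl w))

  -- Neighbours of `w` have the other colour, so none of them has the same distance to `v` as `w`.
  -- Every neighbour is thus counted by `c` or by `b`.
  c+b≡k : ∀ {i} → 0 < i → i ≤ d → c i + b i ≡ k
  c+b≡k {suc i} _ i<d with attained i<d
  ... | v , w , eq = begin
    c (suc i) + b (suc i)
      ≡⟨ cong₂ _+_ (c-sum i eq) (b-sum (suc i) eq) ⟨
    ∑[ z < n ] (A w z * E i v z) + ∑[ z < n ] (A w z * E (2 + i) v z)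
      ≡⟨ ∑-distrib-+ (λ z → A w z * E i v z) (λ z → A w z * E (2 + i) v z) ⟨
    ∑[ z < n ] (A w z * E i v z + A w z * E (2 + i) v z)
      ≡⟨ sum-cong-≗ (λ z → trans (sym (*-distribˡ-+ (A w z) (E i v z) (E (2 + i) v z)))
           (trans (⟦⟧-*-cong (w ∼? z) (one z)) (*-identityʳ (A w z)))) ⟩
    ∑[ z < n ] A w z
      ≡⟨ degree w ⟩
    k ∎
    where
    open ≡-Reasoning
    one : ∀ z → w ∼ z → E i v z + E (2 + i) v z ≡ 1
    one z w∼z with <-cmp (δ v z) (suc i)
    ... | tri< lt _ _ = cong₂ _+_ (⟦⟧-yes (δ v z ≟ i) δvz) (⟦⟧-no (δ v z ≟ 2 + i) λ eq′ → <⇒≢ (m<n+m i z<s) (trans (sym δvz) eq′))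
      where
      δvz : δ v z ≡ i
      δvz = ≤-antisym (s≤s⁻¹ lt) (s≤s⁻¹ (subst (_≤ suc (δ v z)) eq (δ-stepʳ v (∼-sym w∼z))))
    ... | tri≈ _ δvz _ = contradiction
      (trans (colour-δ v w) (trans (cong (λ h → alternate h (colour v)) (trans eq (sym δvz))) (sym (colour-δ v z))))
      (proper w∼z)
    ... | tri> _ _ gt = cong₂ _+_ (⟦⟧-no (δ v z ≟ i) λ eq′ → <⇒≢ (m<n+m i z<s) (trans (sym eq′) δvz)) (⟦⟧-yes (δ v z ≟ 2 + i) δvz)
      where
      δvz : δ v z ≡ 2 + i
      δvz = ≤-antisym (subst (λ h → δ v z ≤ suc h) eq (δ-stepʳ v w∼z)) gt

  c≤k : ∀ {i} → suc i ≤ d → c (suc i) ≤ k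
  c≤k i<d = m+n≤o⇒m≤o _ (≤-reflexive (c+b≡k z<s i<d))

  b≤k : ∀ {i} → suc i ≤ d → b (suc i) ≤ k
  b≤k i<d = m+n≤o⇒n≤o _ (≤-reflexive (c+b≡k z<s i<d))

  c-positive : ∀ {i} → suc i ≤ d → 0 < c (suc i)
  c-positive i<d = c>0 (proj₂ (proj₂ (attained i<d)))

  -- Let `v′` be the first vertex after `v` on a geodesic to `w`. Every neighbour of `w` that is
  -- closer to `v′` than `w` is also closer to `v` than `w`.
  c-step : ∀ {i} → 0 < i → suc i ≤ d → c i ≤ c (suc i)
  c-step {suc i} _ i+2≤d with attained i+2≤d
  ... | v , w , eq with δ-pred eq
  ...   | v′ , v∼v′ , δv′w = subst₂ _≤_ (c-sum i δv′w) (c-sum (suc i) eq) (∑-mono λ z →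
    ⟦⟧-*-mono (w ∼? z) λ w∼z → ⟦⟧-mono (δ v′ z ≟ i) (δ v z ≟ suc i) λ δv′z →
      ≤-antisym (subst (λ h → δ v z ≤ suc h) δv′z (δ-stepˡ z v∼v′))
                (s≤s⁻¹ (subst (_≤ suc (δ v z)) eq (δ-stepʳ v (∼-sym w∼z)))))

  c-mono : ∀ {i j} → 0 < i → i ≤ j → j ≤ d → c i ≤ c j
  c-mono {i} {zero}  0<i i≤0 _ = contradiction i≤0 (<⇒≱ 0<i)
  c-mono {i} {suc j} 0<i i≤1+j j<d with m≤n⇒m<n∨m≡n i≤1+j
  ... | inj₂ refl      = ≤-refl
  ... | inj₁ (s≤s i≤j) = ≤-trans (c-mono 0<i i≤j (<⇒≤ j<d)) (c-step (<-≤-trans 0<i i≤j) j<d)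

  -- The middle vertex of a geodesic of length 4 has disjoint sets of c₂
  -- neighbours adjacent to the two ends.
  2c₂≤k : c 2 + c 2 ≤ k
  2c₂≤k = begin
    c 2 + c 2
      ≡⟨ cong₂ _+_ (c-sum 1 δuw) (c-sum 1 (trans (δ-sym v w) δwv)) ⟨
    ∑[ z < n ] (A w z * E 1 u z) + ∑[ z < n ] (A w z * E 1 v z)
      ≡⟨ ∑-distrib-+ (λ z → A w z * E 1 u z) (λ z → A w z * E 1 v z) ⟨
    ∑[ z < n ] (A w z * E 1 u z + A w z * E 1 v z)
      ≤⟨ ∑-mono (λ z → ≤-trans (≤-reflexive (sym (*-distribˡ-+ (A w z) (E 1 u z) (E 1 v z))))
           (≤-trans (*-monoʳ-≤ (A w z) (⟦⟧-disjoint (δ u z ≟ 1) (δ v z ≟ 1) (far z))) (≤-reflexive (*-identityʳ (A w z))))) ⟩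
    ∑[ z < n ] A w z
      ≡⟨ degree w ⟩
    k ∎
    where
    open ≤-Reasoning
    geodesic : ∃₂ λ u v → ∃ λ w → δ u v ≡ 4 × δ u w ≡ 2 × δ w v ≡ 2
    geodesic = let u , v , eq = attained 4≤d ; w , δuw , δwv = between 2 eq in u , v , w , eq , δuw , δwv
    u = proj₁ geodesic
    v = proj₁ (proj₂ geodesic)
    w = proj₁ (proj₂ (proj₂ geodesic))
    eq = proj₁ (proj₂ (proj₂ (proj₂ geodesic)))
    δuw = proj₁ (proj₂ (proj₂ (proj₂ (proj₂ geodesic))))
    δwv = proj₂ (proj₂ (proj₂ (proj₂ (proj₂ geodesic))))
    far : ∀ z → δ u z ≡ 1 → δ v z ≢ 1
    far z δuz δvz = contradiction
      (subst₂ _≤_ eq (cong₂ _+_ δuz (trans (δ-sym z v) δvz)) (δ-triangle u z v)) λ { (s≤s (s≤s ())) }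

  k>0 : 0 < k
  k>0 = ≤-trans (c-positive (≤-trans (s≤s (s≤s z≤n)) 4≤d)) (≤-trans (m≤m+n (c 2) (c 2)) 2c₂≤k)

  b-last : b d ≡ 0
  b-last with proj₂ diameter
  ... | u , v , dist = trans (sym (b-sum d (Dist⇒δ dist))) (∑≡0 λ z →
    trans (cong (A v z *_) (⟦⟧-no (δ u z ≟ suc d) λ eq → <⇒≱ (n<1+n d) (subst (_≤ d) eq (δ≤d u z)))) (*-zeroʳ (A v z)))

  -- Each neighbour of `u` is either one of the `c 2` common neighbours with `v` or distinguishes
  -- `u` from `v`. Double this inequality and absorb `2 c₂` into `k`.
  k≤2D : ∀ {u v} → δ u v ≡ 2 → k ≤ D u v + D u v
  k≤2D {u} {v} eq = +-cancelˡ-≤ k k (D u v + D u v) (begin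
    k + k                                ≤⟨ +-mono-≤ k≤c₂+D k≤c₂+D ⟩
    c 2 + D u v + (c 2 + D u v)          ≡⟨ double-+ (c 2) (D u v) ⟩
    c 2 + c 2 + (D u v + D u v)          ≤⟨ +-monoˡ-≤ (D u v + D u v) 2c₂≤k ⟩
    k + (D u v + D u v)                  ∎)
    where
    open ≤-Reasoning
    split : ∀ w → u ∼ w → (u ∼ w × δ v w ≡ 1) ⊎ (δ u w ≢ δ v w)
    split w u∼w with δ v w ≟ 1
    ... | yes δvw = inj₁ (u∼w , δvw)
    ... | no  δvw = inj₂ λ eq′ → δvw (trans (sym eq′) (∼⇒δ≡1 u∼w))
    k≤c₂+D : k ≤ c 2 + D u v
    k≤c₂+D = begin
      k                                                ≡⟨ degree u ⟨
      ∑[ w < n ] A u w                                 ≤⟨ ∑-mono (λ w → ⟦⟧-∪ (u ∼? w) ((u ∼? w) ×-dec (δ v w ≟ 1)) (¬? (δ u w ≟ δ v w)) (split w)) ⟩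
      ∑[ w < n ] (⟦ (u ∼? w) ×-dec (δ v w ≟ 1) ⟧ + ⟦ ¬? (δ u w ≟ δ v w) ⟧)
                                                       ≡⟨ ∑-distrib-+ (λ w → ⟦ (u ∼? w) ×-dec (δ v w ≟ 1) ⟧) (λ w → ⟦ ¬? (δ u w ≟ δ v w) ⟧) ⟩
      ∑[ w < n ] ⟦ (u ∼? w) ×-dec (δ v w ≟ 1) ⟧ + D u v  ≡⟨ cong (_+ D u v) (sum-cong-≗ λ w → ⟦⟧-× (u ∼? w) (δ v w ≟ 1)) ⟩
      ∑[ w < n ] (A u w * E 1 v w) + D u v             ≡⟨ cong (_+ D u v) (c-sum 1 (trans (δ-sym v u) eq)) ⟩
      c 2 + D u v                                      ∎

  n≤[1+d]*bound : ∀ x y → (∀ {i} → i ≤ d → K i x ≤ y) → n ≤ suc d * y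
  n≤[1+d]*bound x y K≤y = begin
    n                              ≡⟨ ∑K≡n x ⟨
    ∑[ i < suc d ] K (toℕ i) x     ≤⟨ ∑-mono (λ (i : Fin (suc d)) → K≤y (s≤s⁻¹ (toℕ<n i))) ⟩
    ∑[ i < suc d ] y               ≡⟨ ∑-const (suc d) y ⟩
    suc d * y                      ∎
    where open ≤-Reasoning

  -- Sphere growth when the valency is at most `4 * c 2`

  module _ (k≤4c₂ : k ≤ 4 * c 2) (x : Fin n) where

    K₀≡1 : K 0 x ≡ 1
    K₀≡1 = trans (sum-cong-≗ λ w → trans (⟦⟧-cong (δ x w ≟ 0) (x Fin.≟ w) δ≡0⇒≡ (λ { refl → δ-refl x }))
      (sym (*-identityʳ ⟦ x Fin.≟ w ⟧))) (∑-point (λ _ → 1) x)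

    K₁≡k : K 1 x ≡ k
    K₁≡k = trans (sum-cong-≗ λ w → ⟦⟧-cong (δ x w ≟ 1) (x ∼? w) δ≡1⇒∼ ∼⇒δ≡1) (degree x)

    -- From radius 1 on, consecutive sizes have ratio at most `k / c 2`, hence at most 4. The
    -- comparison with `c 2` starts at `c 2` itself, so the step from radius 0 to 1 contributes the
    -- factor `k`.
    K≤4^i*k : ∀ i → i ≤ d → K i x ≤ 4 ^ i * k
    K≤4^i*k zero          _     = ≤-trans (≤-reflexive K₀≡1) (≤-trans k>0 (≤-reflexive (sym (*-identityˡ k))))
    K≤4^i*k (suc zero)    _     = ≤-trans (≤-reflexive K₁≡k) (m≤n*m k 4)
    K≤4^i*k (suc (suc i)) 2+i≤d = *-cancelʳ-≤ _ _ (c (2 + i)) {{>-nonZero (c-positive 2+i≤d)}} (begin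
      K (2 + i) x * c (2 + i)             ≡⟨ K-step (suc i) x ⟨
      K (1 + i) x * b (1 + i)             ≤⟨ *-mono-≤ (K≤4^i*k (suc i) (<⇒≤ 2+i≤d)) (b≤k (<⇒≤ 2+i≤d)) ⟩
      4 ^ suc i * k * k                   ≤⟨ *-monoʳ-≤ (4 ^ suc i * k) k≤4c₂ ⟩
      4 ^ suc i * k * (4 * c 2)           ≤⟨ *-monoʳ-≤ (4 ^ suc i * k) (*-monoʳ-≤ 4 (c-mono z<s (s≤s (s≤s z≤n)) 2+i≤d)) ⟩
      4 ^ suc i * k * (4 * c (2 + i))     ≡⟨ rearrange (4 ^ suc i) k (c (2 + i)) ⟩
      4 ^ suc (suc i) * k * c (2 + i)     ∎)
      where
      open ≤-Reasoning
      rearrange : ∀ e k c → e * k * (4 * c) ≡ 4 * e * k * c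
      rearrange = solve 3 (λ e k c → e :* k :* (con 4 :* c) := con 4 :* e :* k :* c) refl

    n≤[1+d]*4^d*k : n ≤ suc d * (4 ^ d * k)
    n≤[1+d]*4^d*k = n≤[1+d]*bound x (4 ^ d * k) λ {i} i≤d →
      ≤-trans (K≤4^i*k i i≤d) (*-monoˡ-≤ k (^-monoʳ-≤ 4 i≤d))

  -- Sphere sizes around the threshold index

  module Threshold {t : ℕ} (t≤d : t ≤ d) (small : b t + b t < k) (large : ∀ {j} → j < t → k ≤ b j + b j)
                   (x : Fin n) where

    -- Below the threshold `c (suc i) ≤ k ≤ 2 b i`, so one step towards the centre at most doubles
    -- the size. The recursion is on the gap `e` to `t`.
    K-below : ∀ e i → e + i ≡ t → K i x ≤ 2 ^ e * K t x
    K-below zero    i refl = ≤-reflexive (sym (*-identityˡ _))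
    K-below (suc e) i eq   = *-cancelʳ-≤ _ _ (b i) {{>-nonZero b>0}} (begin
      K i x * b i                         ≡⟨ K-step i x ⟩
      K (suc i) x * c (suc i)             ≤⟨ *-mono-≤ (K-below e (suc i) (trans (+-suc e i) eq)) (≤-trans (c≤k (≤-trans i<t t≤d)) (large i<t)) ⟩
      2 ^ e * K t x * (b i + b i)         ≡⟨ rearrange (2 ^ e) (K t x) (b i) ⟩
      2 ^ suc e * K t x * b i             ∎)
      where
      open ≤-Reasoning
      rearrange : ∀ e k c → e * k * (c + c) ≡ 2 * e * k * c
      rearrange = solve 3 (λ e k c → e :* k :* (c :+ c) := con 2 :* e :* k :* c) refl
      i<t : i < t
      i<t = subst (suc i ≤_) eq (s≤s (m≤n+m i e))
      b>0 : 0 < b i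
      b>0 = n≢0⇒n>0 λ b≡0 → <⇒≱ k>0 (subst (λ y → k ≤ y + y) b≡0 (large i<t))

    t>0 : 0 < t
    t>0 = n≢0⇒n>0 λ t≡0 → ≤⇒≯ (m≤m+n k k) (subst (λ j → b j + b j < k) t≡0 small)

    k<2c : k < c t + c t
    k<2c = +-cancelʳ-< k k (c t + c t) (begin-strict
      k + k                      ≡⟨ cong₂ _+_ (c+b≡k t>0 t≤d) (c+b≡k t>0 t≤d) ⟨
      c t + b t + (c t + b t)    ≡⟨ double-+ (c t) (b t) ⟩
      c t + c t + (b t + b t)    <⟨ +-monoʳ-< (c t + c t) small ⟩
      c t + c t + k              ∎)
      where open ≤-Reasoning

    -- From `t` on, `c i` exceeds `k/2` by monotonicity, so its complement `b i` stays below `k/2`.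
    -- Hence spheres no longer grow.
    b≤c : ∀ {i} → t ≤ i → suc i ≤ d → b i ≤ c (suc i)
    b≤c {i} t≤i i<d = ≤-trans (+-cancelˡ-≤ (c t) (b i) (c t) (begin
      c t + b i    ≤⟨ +-monoˡ-≤ (b i) (c-mono t>0 t≤i (<⇒≤ i<d)) ⟩
      c i + b i    ≡⟨ c+b≡k (<-≤-trans t>0 t≤i) (<⇒≤ i<d) ⟩
      k            ≤⟨ <⇒≤ k<2c ⟩
      c t + c t    ∎)) (c-mono t>0 (m≤n⇒m≤1+n t≤i) i<d)
      where open ≤-Reasoning

    K-above : ∀ e → e + t ≤ d → K (e + t) x ≤ K t x
    K-above zero    _     = ≤-refl
    K-above (suc e) e+t<d = *-cancelʳ-≤ _ _ (c (suc e + t)) {{>-nonZero (c-positive e+t<d)}} (begin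
      K (suc e + t) x * c (suc e + t)    ≡⟨ K-step (e + t) x ⟨
      K (e + t) x * b (e + t)            ≤⟨ *-mono-≤ (K-above e (<⇒≤ e+t<d)) (b≤c (m≤n+m t e) e+t<d) ⟩
      K t x * c (suc e + t)              ∎)
      where open ≤-Reasoning

    n≤[1+d]*2^d*K : n ≤ suc d * (2 ^ d * K t x)
    n≤[1+d]*2^d*K = n≤[1+d]*bound x (2 ^ d * K t x) K≤
      where
      K≤ : ∀ {i} → i ≤ d → K i x ≤ 2 ^ d * K t x
      K≤ {i} i≤d with ≤-total i t
      ... | inj₁ i≤t = ≤-trans (K-below (t ∸ i) i (m∸n+n≡m i≤t)) (*-monoˡ-≤ (K t x) (^-monoʳ-≤ 2 (≤-trans (m∸n≤m t i) t≤d)))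
      ... | inj₂ t≤i = ≤-trans (subst (λ j → K j x ≤ K t x) (m∸n+n≡m t≤i) (K-above (i ∸ t) (subst (_≤ d) (sym (m∸n+n≡m t≤i)) i≤d)))
                               (m≤n*m (K t x) (2 ^ d) {{m^n≢0 2 d}})

  -- The support of an automorphism

  module Automorphism (σ : Permutation′ n) (aut : IsAutomorphism X σ) where

    support : ℕ
    support = ∑[ v < n ] ⟦ ¬? ((σ ⟨$⟩ʳ v) Fin.≟ v) ⟧

    walk-σ : ∀ l {u v} → Walk graph l u v → Walk graph l (σ ⟨$⟩ʳ u) (σ ⟨$⟩ʳ v)
    walk-σ zero    refl        = refl
    walk-σ (suc l) (w , e , q) = σ ⟨$⟩ʳ w , Equivalence.to (aut _ _) e , walk-σ l q

    walk-σ⁻¹ : ∀ l {u v} → Walk graph l (σ ⟨$⟩ʳ u) (σ ⟨$⟩ʳ v) → Walk graph l u v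
    walk-σ⁻¹ zero    eq = trans (sym (inverseˡ σ)) (trans (cong (σ ⟨$⟩ˡ_) eq) (inverseˡ σ))
    walk-σ⁻¹ (suc l) {u} {v} (w , e , q) = σ ⟨$⟩ˡ w
      , Equivalence.from (aut _ _) (subst ((σ ⟨$⟩ʳ u) ∼_) (sym (inverseʳ σ)) e)
      , walk-σ⁻¹ l (subst (λ y → Walk graph l y (σ ⟨$⟩ʳ v)) (sym (inverseʳ σ)) q)

    δ-σ : ∀ u v → δ (σ ⟨$⟩ʳ u) (σ ⟨$⟩ʳ v) ≡ δ u v
    δ-σ u v = ≤-antisym (Walk⇒δ≤ _ (walk-σ _ (walk-δ u v))) (Walk⇒δ≤ _ (walk-σ⁻¹ _ (walk-δ (σ ⟨$⟩ʳ u) (σ ⟨$⟩ʳ v))))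

    -- A fixed vertex is equally far from `u` and from its image, so only moved vertices distinguish
    -- the two.
    D≤support : ∀ u → D u (σ ⟨$⟩ʳ u) ≤ support
    D≤support u = ∑-mono λ w → ⟦⟧-mono (¬? (δ u w ≟ δ (σ ⟨$⟩ʳ u) w)) (¬? ((σ ⟨$⟩ʳ w) Fin.≟ w)) λ ne fixed →
      ne (trans (sym (δ-σ u w)) (cong (δ (σ ⟨$⟩ʳ u)) fixed))

    -- By parity no vertex has equal distances to two vertices of different colours, so every vertex
    -- distinguishes `u` from its image.
    n≤support : ∀ u → colour u ≢ colour (σ ⟨$⟩ʳ u) → n ≤ support
    n≤support u ne = ≤-trans (≤-reflexive (sym total)) (D≤support u)
      where
      total : D u (σ ⟨$⟩ʳ u) ≡ n
      total = trans (sum-cong-≗ λ w → ⟦⟧-yes (¬? (δ u w ≟ δ (σ ⟨$⟩ʳ u) w)) λ eq → ne (alternate-injective (δ u w)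
                (trans (sym (colour-δ u w)) (trans (colour-δ (σ ⟨$⟩ʳ u) w) (cong (λ h → alternate h (colour (σ ⟨$⟩ʳ u))) (sym eq))))))
              (trans (∑-const n 1) (*-identityʳ n))

    -- A fixed neighbour of `x` is also a neighbour of the image of `x`. If there is one, `x` and
    -- its image are distinct and of the same colour, hence at distance exactly 2 with `c 2` common
    -- neighbours.
    fixed-neighbours : ∀ {x} → σ ⟨$⟩ʳ x ≢ x → ∑[ z < n ] (A x z * ⟦ (σ ⟨$⟩ʳ z) Fin.≟ z ⟧) ≤ c 2
    fixed-neighbours {x} moved with any? (λ z → (x ∼? z) ×-dec ((σ ⟨$⟩ʳ z) Fin.≟ z))
    ... | no  none = ≤-trans (≤-reflexive (∑≡0 λ z → trans (sym (⟦⟧-× (x ∼? z) ((σ ⟨$⟩ʳ z) Fin.≟ z)))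
                       (⟦⟧-no ((x ∼? z) ×-dec ((σ ⟨$⟩ʳ z) Fin.≟ z)) λ both → none (z , both)))) z≤n
    ... | yes (y , x∼y , fixed) = ≤-trans (∑-mono λ z → ⟦⟧-*-mono (x ∼? z) λ x∼z →
                       ⟦⟧-mono ((σ ⟨$⟩ʳ z) Fin.≟ z) (δ (σ ⟨$⟩ʳ x) z ≟ 1) λ fixed-z → ∼⇒δ≡1 (image x∼z fixed-z))
                     (≤-reflexive (c-sum 1 δ≡2))
      where
      image : ∀ {z} → x ∼ z → σ ⟨$⟩ʳ z ≡ z → (σ ⟨$⟩ʳ x) ∼ z
      image x∼z fixed-z = subst ((σ ⟨$⟩ʳ x) ∼_) fixed-z (Equivalence.to (aut _ _) x∼z)
      walk : Walk graph 2 (σ ⟨$⟩ʳ x) x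
      walk = y , image x∼y fixed , x , ∼-sym x∼y , refl
      same-colour : colour x ≡ colour (σ ⟨$⟩ʳ x)
      same-colour = trans (colour-walk 2 walk) (not-involutive _)
      δ≡2 : δ (σ ⟨$⟩ʳ x) x ≡ 2
      δ≡2 = ≤-antisym (Walk⇒δ≤ 2 walk) (≤∧≢⇒< (n≢0⇒n>0 (λ δ≡0 → moved (δ≡0⇒≡ δ≡0)))
              λ 1≡δ → proper (δ≡1⇒∼ (sym 1≡δ)) (sym same-colour))

    -- Moved vertices on the spheres around a vertex

    module _ (x : Fin n) where

      moved? : ∀ i y → Dec (δ x y ≡ i × σ ⟨$⟩ʳ y ≢ y)
      moved? i y = (δ x y ≟ i) ×-dec ¬? ((σ ⟨$⟩ʳ y) Fin.≟ y)

      s : ℕ → ℕ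
      s i = ∑[ y < n ] ⟦ moved? i y ⟧

      -- Count edges between moved vertices of consecutive spheres: a moved `y` sends out at least
      -- `b i - c 2` of them, and a moved `z` receives at most `c (suc i)`. The additive form avoids
      -- truncated subtraction.
      s-step : ∀ i → s i * b i ≤ s (suc i) * c (suc i) + s i * c 2
      s-step i = begin
        s i * b i
          ≡⟨ *-distribʳ-sum (b i) (λ y → ⟦ moved? i y ⟧) ⟩
        ∑[ y < n ] (⟦ moved? i y ⟧ * b i)
          ≤⟨ ∑-mono (λ y → ⟦⟧-*-mono (moved? i y) (out y)) ⟩
        ∑[ y < n ] (⟦ moved? i y ⟧ * (∑[ z < n ] (A y z * ⟦ moved? (suc i) z ⟧) + c 2))
          ≡⟨ sum-cong-≗ (λ y → *-distribˡ-+ ⟦ moved? i y ⟧ (∑[ z < n ] (A y z * ⟦ moved? (suc i) z ⟧)) (c 2)) ⟩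
        ∑[ y < n ] (⟦ moved? i y ⟧ * ∑[ z < n ] (A y z * ⟦ moved? (suc i) z ⟧) + ⟦ moved? i y ⟧ * c 2)
          ≡⟨ ∑-distrib-+ (λ y → ⟦ moved? i y ⟧ * ∑[ z < n ] (A y z * ⟦ moved? (suc i) z ⟧)) (λ y → ⟦ moved? i y ⟧ * c 2) ⟩
        ∑[ y < n ] (⟦ moved? i y ⟧ * ∑[ z < n ] (A y z * ⟦ moved? (suc i) z ⟧)) + ∑[ y < n ] (⟦ moved? i y ⟧ * c 2)
          ≡⟨ cong₂ _+_ (∑-swap A (λ y → ⟦ moved? i y ⟧) (λ z → ⟦ moved? (suc i) z ⟧)) (sym (*-distribʳ-sum (c 2) (λ y → ⟦ moved? i y ⟧))) ⟩
        ∑[ z < n ] (⟦ moved? (suc i) z ⟧ * ∑[ y < n ] (A y z * ⟦ moved? i y ⟧)) + s i * c 2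
          ≤⟨ +-monoˡ-≤ (s i * c 2) (∑-mono (λ z → ⟦⟧-*-mono (moved? (suc i) z) (into z))) ⟩
        ∑[ z < n ] (⟦ moved? (suc i) z ⟧ * c (suc i)) + s i * c 2
          ≡⟨ cong (_+ s i * c 2) (*-distribʳ-sum (c (suc i)) (λ z → ⟦ moved? (suc i) z ⟧)) ⟨
        s (suc i) * c (suc i) + s i * c 2
          ∎
        where
        open ≤-Reasoning
        split : ∀ z → δ x z ≡ suc i → (δ x z ≡ suc i × σ ⟨$⟩ʳ z ≢ z) ⊎ (σ ⟨$⟩ʳ z ≡ z)
        split z eq with (σ ⟨$⟩ʳ z) Fin.≟ z
        ... | yes fixed = inj₂ fixed
        ... | no  moved = inj₁ (eq , moved)

        out : ∀ y → δ x y ≡ i × σ ⟨$⟩ʳ y ≢ y → b i ≤ ∑[ z < n ] (A y z * ⟦ moved? (suc i) z ⟧) + c 2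
        out y (eq , moved) = begin
          b i
            ≡⟨ b-sum i eq ⟨
          ∑[ z < n ] (A y z * E (suc i) x z)
            ≤⟨ ∑-mono (λ z → *-monoʳ-≤ (A y z) (⟦⟧-∪ (δ x z ≟ suc i) (moved? (suc i) z) ((σ ⟨$⟩ʳ z) Fin.≟ z) (split z))) ⟩
          ∑[ z < n ] (A y z * (⟦ moved? (suc i) z ⟧ + ⟦ (σ ⟨$⟩ʳ z) Fin.≟ z ⟧))
            ≡⟨ sum-cong-≗ (λ z → *-distribˡ-+ (A y z) ⟦ moved? (suc i) z ⟧ ⟦ (σ ⟨$⟩ʳ z) Fin.≟ z ⟧) ⟩
          ∑[ z < n ] (A y z * ⟦ moved? (suc i) z ⟧ + A y z * ⟦ (σ ⟨$⟩ʳ z) Fin.≟ z ⟧)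
            ≡⟨ ∑-distrib-+ (λ z → A y z * ⟦ moved? (suc i) z ⟧) (λ z → A y z * ⟦ (σ ⟨$⟩ʳ z) Fin.≟ z ⟧) ⟩
          ∑[ z < n ] (A y z * ⟦ moved? (suc i) z ⟧) + ∑[ z < n ] (A y z * ⟦ (σ ⟨$⟩ʳ z) Fin.≟ z ⟧)
            ≤⟨ +-monoʳ-≤ (∑[ z < n ] (A y z * ⟦ moved? (suc i) z ⟧)) (fixed-neighbours moved) ⟩
          ∑[ z < n ] (A y z * ⟦ moved? (suc i) z ⟧) + c 2
            ∎

        into : ∀ z → δ x z ≡ suc i × σ ⟨$⟩ʳ z ≢ z → ∑[ y < n ] (A y z * ⟦ moved? i y ⟧) ≤ c (suc i)
        into z (eq , _) = begin
          ∑[ y < n ] (A y z * ⟦ moved? i y ⟧)  ≤⟨ ∑-mono (λ y → *-mono-≤ (≤-reflexive (A-sym y z)) (⟦⟧-mono (moved? i y) (δ x y ≟ i) proj₁)) ⟩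
          ∑[ y < n ] (A z y * E i x y)         ≡⟨ c-sum i eq ⟩
          c (suc i)                            ∎

      s≤support : ∀ i → s i ≤ support
      s≤support i = ∑-mono λ y → ⟦⟧-mono (moved? i y) (¬? ((σ ⟨$⟩ʳ y) Fin.≟ y)) proj₂

      -- With `2 c₂ ≤ b i`, the moved vertices follow the recursion `K-step` of the whole spheres up
      -- to a factor of 2 at each step.
      K≤2^i*s : σ ⟨$⟩ʳ x ≢ x → ∀ i → i ≤ d → (∀ {j} → j < i → c 2 + c 2 ≤ b j) → K i x ≤ 2 ^ i * s i
      K≤2^i*s moved zero _ _ = ≤-trans (∑-mono λ y → ⟦⟧-mono (δ x y ≟ 0) (moved? 0 y)
        λ eq → eq , subst (λ y → σ ⟨$⟩ʳ y ≢ y) (δ≡0⇒≡ eq) moved) (≤-reflexive (sym (*-identityˡ (s 0))))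
      K≤2^i*s moved (suc i) i<d 2c₂≤b = *-cancelʳ-≤ _ _ (c (suc i)) {{>-nonZero (c-positive i<d)}} (begin
        K (suc i) x * c (suc i)                        ≡⟨ K-step i x ⟨
        K i x * b i                                    ≤⟨ *-monoˡ-≤ (b i) (K≤2^i*s moved i (<⇒≤ i<d) (2c₂≤b ∘ m<n⇒m<1+n)) ⟩
        2 ^ i * s i * b i                              ≡⟨ *-assoc (2 ^ i) (s i) (b i) ⟩
        2 ^ i * (s i * b i)                            ≤⟨ *-monoʳ-≤ (2 ^ i) half ⟩
        2 ^ i * (s (suc i) * c (suc i) + s (suc i) * c (suc i))  ≡⟨ rearrange (2 ^ i) (s (suc i)) (c (suc i)) ⟩
        2 ^ suc i * s (suc i) * c (suc i)              ∎)
        where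
        open ≤-Reasoning
        rearrange : ∀ e k c → e * (k * c + k * c) ≡ 2 * e * k * c
        rearrange = solve 3 (λ e k c → e :* (k :* c :+ k :* c) := con 2 :* e :* k :* c) refl
        regroup : ∀ x s c → x + s * c + (x + s * c) ≡ x + x + s * (c + c)
        regroup = solve 3 (λ x s c → x :+ s :* c :+ (x :+ s :* c) := x :+ x :+ s :* (c :+ c)) refl
        -- Double `s-step`; the two error terms together are at most one copy of `s i * b i`, which
        -- cancels.
        half : s i * b i ≤ s (suc i) * c (suc i) + s (suc i) * c (suc i)
        half = +-cancelʳ-≤ (s i * b i) _ _ (begin
          s i * b i + s i * b i
            ≤⟨ +-mono-≤ (s-step i) (s-step i) ⟩
          s (suc i) * c (suc i) + s i * c 2 + (s (suc i) * c (suc i) + s i * c 2)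
            ≡⟨ regroup (s (suc i) * c (suc i)) (s i) (c 2) ⟩
          s (suc i) * c (suc i) + s (suc i) * c (suc i) + s i * (c 2 + c 2)
            ≤⟨ +-monoʳ-≤ (s (suc i) * c (suc i) + s (suc i) * c (suc i)) (*-monoʳ-≤ (s i) (2c₂≤b (n<1+n i))) ⟩
          s (suc i) * c (suc i) + s (suc i) * c (suc i) + s i * b i
            ∎)

      motion-sparse : σ ⟨$⟩ʳ x ≢ x → 4 * c 2 ≤ k → n ≤ suc d * (2 ^ d * (2 ^ d * support))
      motion-sparse moved 4c₂≤k = begin
        n                                     ≤⟨ Threshold.n≤[1+d]*2^d*K t≤d small large x ⟩
        suc d * (2 ^ d * K t x)               ≤⟨ *-monoʳ-≤ (suc d) (*-monoʳ-≤ (2 ^ d) K≤) ⟩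
        suc d * (2 ^ d * (2 ^ d * support))   ∎
        where
        open ≤-Reasoning
        threshold : ∃ λ t → t ≤ d × b t + b t < k × (∀ {j} → j < t → ¬ (b j + b j < k))
        -- Since `b d` is 0 and `k` is positive, index `d` meets the condition and bounds the
        -- search.
        threshold = first (λ j → b j + b j <? k) d (subst (λ y → y + y < k) (sym b-last) k>0)
        t : ℕ
        t = proj₁ threshold
        t≤d : t ≤ d
        t≤d = proj₁ (proj₂ threshold)
        small : b t + b t < k
        small = proj₁ (proj₂ (proj₂ threshold))
        large : ∀ {j} → j < t → k ≤ b j + b j
        large j<t = ≮⇒≥ (proj₂ (proj₂ (proj₂ threshold)) j<t)
        4*≡2*2 : ∀ y → 4 * y ≡ 2 * (y + y)
        4*≡2*2 = solve 1 (λ y → con 4 :* y := con 2 :* (y :+ y)) refl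
        2c₂≤b : ∀ {j} → j < t → c 2 + c 2 ≤ b j
        2c₂≤b {j} j<t = *-cancelˡ-≤ 2 (begin
          2 * (c 2 + c 2)  ≡⟨ 4*≡2*2 (c 2) ⟨
          4 * c 2          ≤⟨ ≤-trans 4c₂≤k (large j<t) ⟩
          b j + b j        ≡⟨ cong (b j +_) (+-identityʳ (b j)) ⟨
          2 * b j          ∎)
        K≤ : K t x ≤ 2 ^ d * support
        K≤ = ≤-trans (K≤2^i*s moved t t≤d 2c₂≤b) (*-mono-≤ (^-monoʳ-≤ 2 t≤d) (s≤support t))

    -- Along a walk whose steps all have the distance of `u` and its image, `D x` grows by at most
    -- the support at each step. It factors through the `d + 1` possible distances from `x`, so
    -- `bounded-on-walk` applies.
    D₂≤[1+d]*support : ∀ {κ u} → Primitive (halvedGraph graph B κ) → σ ⟨$⟩ʳ u ≢ u → colour u ≡ colour (σ ⟨$⟩ʳ u) →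
                       ∃₂ λ x y → δ x y ≡ 2 × D x y ≤ suc d * support
    D₂≤[1+d]*support {κ} {u} (d′ , (bounded′ , (x , x∈) , _) , connected′) moved same
      with alternate-even (δ u (σ ⟨$⟩ʳ u)) (colour u) (trans (sym (colour-δ u (σ ⟨$⟩ʳ u))) (sym same))
    ... | zero  , eq = contradiction (sym (δ≡0⇒≡ eq)) moved
    -- The vertex `x` comes from the pair attaining the diameter of the halved graph, which shows
    -- that colour `κ` occurs; `u` may have the other colour.
    ... | suc j , eq = x , y , δxy ,
      bounded-on-walk (distanceGraph H (suc j)) (λ v → fromℕ< (s≤s (δ≤d x (proj₁ v)))) (λ v → D x (proj₁ v)) support
        (λ v w same-class → D-class (fromℕ<-injective _ _ (s≤s (δ≤d x (proj₁ v))) (s≤s (δ≤d x (proj₁ w))) same-class))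
        (λ {v} {w} dist → ≤-trans (D-triangle x (proj₁ v) (proj₁ w)) (+-monoʳ-≤ (D x (proj₁ v))
          (≤-trans (≤-reflexive (D-class (trans (halved-dist⇒δ dist) (sym eq)))) (D≤support u))))
        (proj₁ path) (proj₂ path) (D-refl x)
      where
      open Halved graph (proj₁ diameter) B κ
      colour-even : ∀ {i z} → δ x z ≡ i → alternate i κ ≡ κ → colour z ≡ κ
      colour-even {i} {z} δxz even = trans (colour-δ x z) (trans (cong₂ alternate δxz x∈) even)
      sphere₂ : ∃ λ y → δ x y ≡ 2
      sphere₂ = sphere-nonempty (proj₂ (proj₂ (attained (≤-trans (s≤s (s≤s z≤n)) 4≤d)))) x
      y = proj₁ sphere₂
      δxy = proj₂ sphere₂
      sphere₂ⱼ : ∃ λ z → δ x z ≡ suc j + suc j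
      sphere₂ⱼ = sphere-nonempty eq x
      -- Primitivity speaks only of radii up to the diameter of the halved graph. A vertex at
      -- distance `2 (suc j)` from `x` shows that this radius is in range.
      j≤d′ : suc j ≤ d′
      j≤d′ = let z , δxz = sphere₂ⱼ
                 i , i≤d′ , dist = bounded′ (x , x∈) (z , colour-even δxz (alternate-double (suc j) κ))
                 2i≡2j = trans (sym (halved-dist⇒δ dist)) δxz
             in subst (_≤ d′) (*-cancelˡ-≡ i (suc j) 2 (trans (cong (i +_) (+-identityʳ i)) (trans 2i≡2j (cong (suc j +_) (sym (+-identityʳ (suc j))))))) i≤d′
      path : ∃ λ l → Walk (distanceGraph H (suc j)) l (x , x∈) (y , colour-even δxy (not-involutive κ))
      path = connected′ (suc j) j≤d′ _ _

    -- The constant is the one produced by the last case, many common neighbours and equal colours;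
    -- it dominates the other two.
    n≤bound*support : ∀ {κ} → Primitive (halvedGraph graph B κ) → ∀ {u} → σ ⟨$⟩ʳ u ≢ u →
                      n ≤ 2 * suc d * suc d * 4 ^ d * support
    n≤bound*support prim {u} moved with 4 * c 2 ≤? k | colour u Bool.≟ colour (σ ⟨$⟩ʳ u)
    ... | yes 4c₂≤k | _ = begin
      n                                       ≤⟨ motion-sparse u moved 4c₂≤k ⟩
      suc d * (2 ^ d * (2 ^ d * support))     ≡⟨ regroup (suc d) (2 ^ d) support ⟩
      -- Both powers combine to 2 to the exponent `2 * d`, which is `4 ^ d`.
      suc d * (2 ^ d * 2 ^ d) * support       ≡⟨ cong (λ y → suc d * y * support) (trans (sym (^-distribˡ-+-* 2 d d)) (trans (cong (λ y → 2 ^ (d + y)) (sym (+-identityʳ d))) (sym (^-*-assoc 2 2 d)))) ⟩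
      suc d * 4 ^ d * support                 ≤⟨ *-monoˡ-≤ support (*-monoˡ-≤ (4 ^ d) (m≤n*m (suc d) (2 * suc d))) ⟩
      2 * suc d * suc d * 4 ^ d * support     ∎
      where
      open ≤-Reasoning
      regroup : ∀ x y z → x * (y * (y * z)) ≡ x * (y * y) * z
      regroup = solve 3 (λ x y z → x :* (y :* (y :* z)) := x :* (y :* y) :* z) refl
    ... | no  _     | no  differ = ≤-trans (n≤support u differ) (m≤n*m support (2 * suc d * suc d * 4 ^ d) {{nz}})
      where
      nz : NonZero (2 * suc d * suc d * 4 ^ d)
      nz = m*n≢0 (2 * suc d * suc d) (4 ^ d) {{_}} {{m^n≢0 4 d}}
    ... | no  4c₂≰k | yes same with D₂≤[1+d]*support prim moved same
    ...   | x , y , δxy , D≤ = begin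
      n                                                            ≤⟨ n≤[1+d]*4^d*k (<⇒≤ (≰⇒> 4c₂≰k)) u ⟩
      suc d * (4 ^ d * k)                                          ≤⟨ *-monoʳ-≤ (suc d) (*-monoʳ-≤ (4 ^ d) (≤-trans (k≤2D δxy) (+-mono-≤ D≤ D≤))) ⟩
      suc d * (4 ^ d * (suc d * support + suc d * support))        ≡⟨ regroup (suc d) (4 ^ d) support ⟩
      2 * suc d * suc d * 4 ^ d * support                          ∎
      where
      open ≤-Reasoning
      regroup : ∀ x y z → x * (y * (x * z + x * z)) ≡ 2 * x * x * y * z
      regroup = solve 3 (λ x y z → x :* (y :* (x :* z :+ x :* z)) := con 2 :* x :* x :* y :* z) refl

-- The factors 2, `d + 1` and `d + 1` are each at most `2 d`, and `4 ^ d` is at most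
-- `(2 d) ^ (2 d)`. This gives exponent `2 d + 3`, which is then raised to `2 d + 5`.
bound≤ : ∀ {d} → 4 ≤ d → 2 * suc d * suc d * 4 ^ d ≤ (2 * d) ^ (2 * d + 5)
bound≤ {d} 4≤d = begin
  2 * suc d * suc d * 4 ^ d                 ≤⟨ *-mono-≤ (*-mono-≤ (*-mono-≤ 2≤ 1+d≤) 1+d≤) 4^d≤ ⟩
  D * D * D * D ^ (2 * d)                   ≡⟨ *-comm (D * D * D) (D ^ (2 * d)) ⟩
  D ^ (2 * d) * (D * D * D)                 ≡⟨ cong (D ^ (2 * d) *_) (cube D) ⟩
  D ^ (2 * d) * D ^ 3                       ≤⟨ *-monoʳ-≤ (D ^ (2 * d)) (^-monoʳ-≤ D {{>-nonZero (≤-trans (s≤s z≤n) 2≤)}} (m≤n+m 3 2)) ⟩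
  D ^ (2 * d) * D ^ 5                       ≡⟨ ^-distribˡ-+-* D (2 * d) 5 ⟨
  D ^ (2 * d + 5)                           ∎
  where
  open ≤-Reasoning
  D = 2 * d
  cube : ∀ x → x * x * x ≡ x ^ 3
  cube = solve 1 (λ x → x :* x :* x := x :^ 3) refl
  1≤d : 1 ≤ d
  1≤d = ≤-trans (s≤s z≤n) 4≤d
  2≤ : 2 ≤ D
  2≤ = *-monoʳ-≤ 2 1≤d
  1+d≤ : suc d ≤ D
  1+d≤ = ≤-trans (+-monoˡ-≤ d 1≤d) (≤-reflexive (cong (d +_) (sym (+-identityʳ d))))
  4^d≤ : 4 ^ d ≤ D ^ (2 * d)
  4^d≤ = ≤-trans (≤-reflexive (^-*-assoc 2 2 d)) (^-monoˡ-≤ (2 * d) 2≤)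

-- The negative power is cleared by multiplication, which keeps the inequality within the natural
-- numbers.
theorem5p4 : ∀ {n d : ℕ} (X : FiniteGraph n) → let open FiniteGraph X in
    IsDistanceRegular X → HasDiameter graph d → 4 ≤ d →
    (B : Bipartition graph) → ∃ (λ c → Primitive (halvedGraph graph B c)) →
    ∀ m → IsMotion X m → n ≤ (2 * d) ^ (2 * d + 5) * m
theorem5p4 {n} {d} X regular diameter 4≤d B (κ , primitive-half) m motion
  with IsMotion.attained motion
-- Take an automorphism attaining the motion, so that `m` becomes the number of vertices it moves; a
-- moved vertex is found by finite search.
... | σ , aut , σ≉id , refl with ¬∀⟶∃¬ n (λ u → σ ⟨$⟩ʳ u ≡ u) (λ u → (σ ⟨$⟩ʳ u) Fin.≟ u) σ≉id
...   | u , moved = begin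
  n                                      ≤⟨ n≤bound*support primitive-half moved ⟩
  2 * suc d * suc d * 4 ^ d * support    ≤⟨ *-monoˡ-≤ support (bound≤ 4≤d) ⟩
  (2 * d) ^ (2 * d + 5) * support        ≡⟨ cong ((2 * d) ^ (2 * d + 5) *_) (#≡∑ (λ v → ¬? ((σ ⟨$⟩ʳ v) Fin.≟ v))) ⟨
  (2 * d) ^ (2 * d + 5) * # (λ v → ¬? ((σ ⟨$⟩ʳ v) Fin.≟ v))  ∎
  where
  open ≤-Reasoning
  open BipartiteDistanceRegular X regular diameter 4≤d B
  open Automorphism σ aut
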